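{- Let $\lambda=(1^{a_1},2^{a_2})$ with $a_1,a_2\ge 2$. If $a_1=a_2=2$, then $\mathrm{Aut}(\mathrm{GT}_\lambda)\cong D_4\times\mathbb{Z}_2$. Otherwise, $\mathrm{Aut}(\mathrm{GT}_\lambda)\cong D_4\times\mathbb{Z}_2\times\mathbb{Z}_2^{\delta_{a_1,a_2}}$, where $\delta_{a_1,a_2}=1$ if $a_1=a_2$ and $0$ otherwise.
   Context: For a partition $\lambda=(\lambda_1\le\cdots\le\lambda_n)$ of positive integers, the Gelfand–Tsetlin polytope $\mathrm{GT}_\lambda$ is the set of points $(x_{i,j})_{1\le j\le i\le n}\in\mathbb{R}^{n(n+1)/2}$ with $x_{i,i}=\lambda_i$ for all $i$ and $x_{i-1,j}\le x_{i,j}\le x_{i+1,j}$, $x_{i,j-1}\le x_{i,j}\le x_{i,j+1}$ whenever the indices lie in $\{(i,j):1\le j\le i\le n\}$. The notation $(1^{a_1},2^{a_2})$ means $a_1$ copies of $1$ followed by $a_2$ copies of $2$. $\mathrm{Aut}(\mathrm{GT}_\lambda)$ denotes the combinatorial automorphism group, i.e. the group of automorphisms of the poset of faces of $\mathrm{GT}_\lambda$ ordered by inclusion. $D_4$ is the dihedral group of order $8$ and $\mathbb{Z}_2$ the cyclic group of order $2$.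
   Formalization: The points of the Gelfand–Tsetlin polytope have rational rather than real coordinates; faces and their inclusions are those of the set of rational points, which gives the same face poset because the polytope is rational. -}

module Defs where

open import Data.Nat using (ℕ; zero; suc; _<ᵇ_; _≡ᵇ_)
open import Data.Nat.Properties using (≤-refl)
open import Data.Fin using (Fin; toℕ)
open import Data.Bool using (Bool; true; false; if_then_else_; not; _xor_)
open import Data.Product using (Σ; Σ-syntax; ∃; _×_; _,_; proj₁; proj₂)
open import Data.Sum using (_⊎_)
open import Data.Unit using (⊤; tt)
open import Data.Vec using (Vec; zipWith)
open import Data.Rational using (ℚ; _≤_; 1ℚ)
open import Relation.Binary.PropositionalEquality using (_≡_)
import Data.Nat as N

-- Gelfand–Tsetlin polytope for λ = (1^{a₁}, 2^{a₂}), n = a₁ + a₂.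
-- Coordinates x_{i,j}, 1 ≤ j ≤ i ≤ n (here 0-based: Fin n, toℕ j ≤ toℕ i).

Idx : ℕ → Set
Idx n = Σ (Fin n × Fin n) (λ ij → toℕ (proj₂ ij) N.≤ toℕ (proj₁ ij))

row col : ∀ {n} → Idx n → ℕ
row ((i , j) , _) = toℕ i
col ((i , j) , _) = toℕ j

diag : ∀ {n} → Fin n → Idx n
diag i = ((i , i) , ≤-refl)

Adj : ∀ {n} → Idx n → Idx n → Set
Adj p q = (row q ≡ suc (row p) × col q ≡ col p)
        ⊎ (row q ≡ row p × col q ≡ suc (col p))

lam : (a₁ a₂ : ℕ) → Fin (a₁ N.+ a₂) → ℚ
lam a₁ a₂ i = if toℕ i <ᵇ a₁ then 1ℚ else (1ℚ Data.Rational.+ 1ℚ)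

Point : ℕ → Set
Point n = Idx n → ℚ

InGT : (a₁ a₂ : ℕ) → Point (a₁ N.+ a₂) → Set
InGT a₁ a₂ x = (∀ i → x (diag i) ≡ lam a₁ a₂ i)
             × (∀ p q → Adj p q → x p ≤ x q)

-- A choice of defining inequalities to be made tight.
EdgeSet : ℕ → Set
EdgeSet n = Idx n → Idx n → Bool

-- The face F_S : points of GT_λ where the chosen inequalities are equalities.
-- Every face of GT_λ (including ∅ and GT_λ) is of this form.
InFace : (a₁ a₂ : ℕ) → EdgeSet (a₁ N.+ a₂) → Point (a₁ N.+ a₂) → Set
InFace a₁ a₂ S x = InGT a₁ a₂ x × (∀ p q → Adj p q → S p q ≡ true → x p ≡ x q)

Sub : (a₁ a₂ : ℕ) → EdgeSet (a₁ N.+ a₂) → EdgeSet (a₁ N.+ a₂) → Set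
Sub a₁ a₂ S T = ∀ x → InFace a₁ a₂ S x → InFace a₁ a₂ T x

FaceEq : (a₁ a₂ : ℕ) → EdgeSet (a₁ N.+ a₂) → EdgeSet (a₁ N.+ a₂) → Set
FaceEq a₁ a₂ S T = (Sub a₁ a₂ S T) × (Sub a₁ a₂ T S)

-- Automorphism of the face poset (faces = EdgeSets modulo FaceEq,
-- ordered by inclusion): an order isomorphism, given on representatives.
record Aut (a₁ a₂ : ℕ) : Set where
  field
    fun     : EdgeSet (a₁ N.+ a₂) → EdgeSet (a₁ N.+ a₂)
    monoRefl : ∀ S T → (Sub a₁ a₂ S T → Sub a₁ a₂ (fun S) (fun T))
                     × (Sub a₁ a₂ (fun S) (fun T) → Sub a₁ a₂ S T)
    surj    : ∀ T → ∃ λ S → FaceEq a₁ a₂ (fun S) T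
open Aut public

AutEq : ∀ {a₁ a₂} → Aut a₁ a₂ → Aut a₁ a₂ → Set
AutEq {a₁} {a₂} f g = ∀ S → FaceEq a₁ a₂ (fun f S) (fun g S)

record FinGrp : Set₁ where
  field
    Carrier : Set
    _·_     : Carrier → Carrier → Carrier
open FinGrp public

data Z4 : Set where
  r0 r1 r2 r3 : Z4

sucZ4 : Z4 → Z4
sucZ4 r0 = r1
sucZ4 r1 = r2
sucZ4 r2 = r3
sucZ4 r3 = r0

_+Z4_ : Z4 → Z4 → Z4
r0 +Z4 b = b
r1 +Z4 b = sucZ4 b
r2 +Z4 b = sucZ4 (sucZ4 b)
r3 +Z4 b = sucZ4 (sucZ4 (sucZ4 b))

negZ4 : Z4 → Z4
negZ4 r0 = r0
negZ4 r1 = r3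
negZ4 r2 = r2
negZ4 r3 = r1

-- D₄ (order 8): pairs (r^k, s^e), with s r s⁻¹ = r⁻¹.
D4 : FinGrp
D4 = record
  { Carrier = Z4 × Bool
  ; _·_ = λ { (a , false) (b , t) → (a +Z4 b , t)
            ; (a , true)  (b , t) → (a +Z4 negZ4 b , not t) } }

Z2 : FinGrp
Z2 = record { Carrier = Bool ; _·_ = _xor_ }

Z2^ : ℕ → FinGrp
Z2^ k = record { Carrier = Vec Bool k ; _·_ = zipWith _xor_ }

_⊗_ : FinGrp → FinGrp → FinGrp
G ⊗ H = record
  { Carrier = Carrier G × Carrier H
  ; _·_ = λ x y → (_·_ G (proj₁ x) (proj₁ y) , _·_ H (proj₂ x) (proj₂ y)) }

δ : ℕ → ℕ → ℕ
δ a b = if a ≡ᵇ b then 1 else 0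

_∘A_ : ∀ {a₁ a₂} → Aut a₁ a₂ → Aut a₁ a₂ → Aut a₁ a₂
_∘A_ {a₁} {a₂} f k = record
  { fun = λ S → fun f (fun k S)
  ; monoRefl = λ S T →
      (λ le → proj₁ (monoRefl f _ _) (proj₁ (monoRefl k S T) le))
    , (λ le → proj₂ (monoRefl k S T) (proj₂ (monoRefl f _ _) le))
  ; surj = λ T → let U = proj₁ (surj f T) ; eU = proj₂ (surj f T)
                     S = proj₁ (surj k U) ; eS = proj₂ (surj k U)
                 in S , ( (λ x p → proj₁ eU x (proj₁ (monoRefl f _ _) (proj₁ eS) x p))
                        , (λ x p → proj₁ (monoRefl f _ _) (proj₂ eS) x (proj₂ eU x p)) ) }

AutIso : (a₁ a₂ : ℕ) → FinGrp → Set
AutIso a₁ a₂ G =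
  Σ (Carrier G → Aut a₁ a₂) λ φ →
      (∀ g h → AutEq (φ (_·_ G g h)) (φ g ∘A φ h))
    × (∀ g h → AutEq (φ g) (φ h) → g ≡ h)
    × (∀ (α : Aut a₁ a₂) → ∃ λ g → AutEq (φ g) α)

{-# OPTIONS --safe #-}
module Submission where

-- With A = a₂ − 1 and B = a₁ − 1, GT_λ is the order polytope of an (A + 1) × (B + 1) grid: its vertices are the monotone
-- 0/1 fillings, its facets the cover relations of the grid completed by a bottom and a top. The intersection of two
-- facets lies in a third one exactly when the two form one of the two chains from bottom to top of a unit square
-- and the third belongs to the other chain. An automorphism preserves this incidence, and propagating it along the
-- antidiagonals, from the grid corner (0 , 0) incomparable to the opposite corner (A , B), shows that an
-- automorphism fixing the facets of the square at (0 , 0) fixes all others, up to exchanging the two facets at (A , B)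
-- and the facets bot and top. So the group is generated by the reflection of the entry at (0 , 0) between its two
-- neighbours (twist), the half turn (rotate), the exchange of the two constant vertices (swapApex), and the
-- transposition κ if A = B; twist and rotate generate D₄, with twist ∘ rotate of order 4. For A = B = 1, κ adds nothing.

open import Defs
open import Data.Bool using (Bool; true; false; if_then_else_; not; _xor_; T)
open import Data.Bool.Properties using (not-involutive)
open import Data.Empty using (⊥; ⊥-elim)
open import Data.Fin using (Fin; zero; suc; toℕ; fromℕ<)
open import Data.Fin.Properties using (toℕ-fromℕ<; toℕ-injective; toℕ<n)
open import Data.List using (List; []; _∷_; _++_; map)
open import Data.List.Relation.Unary.All as All using (All; []; _∷_)
import Data.List.Relation.Unary.All.Properties as All
open import Data.List.Relation.Unary.Any as Any using (Any; here; there; any?)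
open import Data.Nat using (ℕ; zero; suc; _+_; _∸_; _≤_; _<_; _≥_; _≤ᵇ_; _<ᵇ_; _≤?_; _<?_; _≟_; z≤n; s≤s; s≤s⁻¹)
open import Data.Nat.Properties
open import Data.Product using (Σ; ∃; _×_; _,_; proj₁; proj₂)
open import Data.Product.Properties using (≡-dec)
open import Data.Rational as ℚ using (ℚ; 1ℚ)
import Data.Rational.Properties as ℚ
open import Data.Sum using (_⊎_; inj₁; inj₂; [_,_]′; swap)
open import Data.Unit using (⊤; tt)
open import Data.Vec using ([]; _∷_)
open import Function using (_∘_; case_of_; id)
open import Relation.Binary.Definitions using (tri<; tri≈; tri>)
open import Relation.Binary.PropositionalEquality using (_≡_; _≢_; refl; sym; trans; cong; cong₂; subst; subst₂)
open import Relation.Nullary using (¬_; Dec; yes; no; does)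
open import Relation.Nullary.Decidable using (dec-true; dec-false; map′; decidable-stable; from-yes; from-no; _×-dec_; _⊎-dec_)

-- An automorphism is determined by its permutation of the facets because every face is the
-- intersection of the facets containing it. The incidences are classified by looking at the
-- vertices off a facet `g`: if the intersection of `e` and `f` lies in `g`, each such vertex is
-- also off `e` or off `f`, and a few extreme lattice paths crossing `g` leave room only for a chain
-- of a unit square. The obstacle in the propagation is a tilt, an automorphism that fixes the two
-- facets at (0 , 0) and exchanges the other two of the first square. Followed by `twist` and `κ` it
-- fixes all four of them, but as a map onto the transposed grid. Rigidity is therefore proved for
-- isomorphisms between grids of possibly different sizes, and it forces A = B. For A = B = 1 the
-- other two facets of the first square are those at (A , B): a tilt is then, up to `swapApex`, the
-- twist at the opposite corner, and `κ` is the product of the two twists and `swapApex`. For A = B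
-- > 1 the facets `H i k` with 0 < k < B stay of type `H` under all other generators, which keeps
-- `κ` independent.

-- Grid coordinates are i = row − a₁ and k = a₁ − 1 − col, and true stands for the value 2: a vertex v is increasing in i
-- and decreasing in k. The facets H i k and V i k equate v i k with v (i + 1) k and v i (k + 1); bot and top say that
-- the least entry v 0 B is 1 and the greatest entry v A 0 is 2.
data Facet : Set where
  bot top : Facet
  H V     : ℕ → ℕ → Facet

Filling : Set
Filling = ℕ → ℕ → Bool

eqb : Bool → Bool → Bool
eqb x y = not (x xor y)

-- Intersections of two facets, tested on lattice paths

module _ (A B : ℕ) where

  Valid : Facet → Set
  Valid bot     = ⊤
  Valid top     = ⊤
  Valid (H i k) = i < A × k ≤ B
  Valid (V i k) = i ≤ A × k < B

  Monotone : Filling → Set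
  Monotone v = (∀ i k → i < A → k ≤ B → v i k ≡ true → v (suc i) k ≡ true)
             × (∀ i k → i ≤ A → k < B → v i (suc k) ≡ true → v i k ≡ true)

  tight : Filling → Facet → Bool
  tight v bot     = not (v 0 B)
  tight v top     = v A 0
  tight v (H i k) = eqb (v i k) (v (suc i) k)
  tight v (V i k) = eqb (v i k) (v i (suc k))

  Meet : Facet → Facet → Facet → Set
  Meet e f g = ∀ v → Monotone v → tight v e ≡ true → tight v f ≡ true → tight v g ≡ true

  -- H i k and V i k (near) are the two sides at the corner (i , k) of a unit square, H i (k + 1) and V (i + 1) k (far) are
  -- the other two; each of these pairs joins the least to the greatest entry of the square.
  data Opp : Facet → Facet → Facet → Set where
    nearHV : ∀ {i k g} → i < A → k < B → g ≡ H i (suc k) ⊎ g ≡ V (suc i) k → Opp (H i k) (V i k) g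
    nearVH : ∀ {i k g} → i < A → k < B → g ≡ H i (suc k) ⊎ g ≡ V (suc i) k → Opp (V i k) (H i k) g
    farHV  : ∀ {i k g} → i < A → k < B → g ≡ H i k ⊎ g ≡ V i k → Opp (H i (suc k)) (V (suc i) k) g
    farVH  : ∀ {i k g} → i < A → k < B → g ≡ H i k ⊎ g ≡ V i k → Opp (V (suc i) k) (H i (suc k)) g

  Opp-sym : ∀ {e f g} → Opp e f g → Opp f e g
  Opp-sym (nearHV p q r) = nearVH p q r
  Opp-sym (nearVH p q r) = nearHV p q r
  Opp-sym (farHV p q r)  = farVH p q r
  Opp-sym (farVH p q r)  = farHV p q r

  -- A lattice path with heights h separates the entries h k ≤ i, which are true, from the others.
  Cross : (ℕ → ℕ) → Facet → Set
  Cross h bot     = h B ≡ 0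
  Cross h top     = A < h 0
  Cross h (H i k) = h k ≡ suc i
  Cross h (V i k) = h k ≤ i × i < h (suc k)

  NonDecr : (ℕ → ℕ) → Set
  NonDecr h = ∀ k → k < B → h k ≤ h (suc k)

  below : (ℕ → ℕ) → Filling
  below h i k = h k ≤ᵇ i

  private
    ≤-of : ∀ m n → (m ≤ᵇ n) ≡ true → m ≤ n
    ≤-of m n eq = ≤ᵇ⇒≤ m n (subst T (sym eq) tt)

    ≰-of : ∀ m n → (m ≤ᵇ n) ≡ false → n < m
    ≰-of m n eq = ≰⇒> (λ p → subst T eq (≤⇒≤ᵇ p))

  below-mono : ∀ {h} → NonDecr h → Monotone (below h)
  below-mono {h} nd = (λ i k _ _ p → dec-true (h k ≤? suc i) (m≤n⇒m≤1+n (≤-of (h k) i p)))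
                    , (λ i k _ k<B p → dec-true (h k ≤? i) (≤-trans (nd k k<B) (≤-of (h (suc k)) i p)))

  cross⇒loose : ∀ h e → Cross h e → tight (below h) e ≡ false
  cross⇒loose h bot c rewrite c = refl
  cross⇒loose h top c = dec-false (h 0 ≤? A) (<⇒≱ c)
  cross⇒loose h (H i k) c rewrite c | dec-false (suc i ≤? i) 1+n≰n | dec-true (suc i ≤? suc i) ≤-refl = refl
  cross⇒loose h (V i k) (c , d) rewrite dec-true (h k ≤? i) c | dec-false (h (suc k) ≤? i) (<⇒≱ d) = refl

  loose⇒cross : ∀ h → NonDecr h → ∀ e → Valid e → tight (below h) e ≡ false → Cross h e
  loose⇒cross h nd bot _ p = n≤0⇒n≡0 (≤-of (h B) 0 (trans (sym (not-involutive _)) (cong not p)))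
  loose⇒cross h nd top _ p = ≰-of (h 0) A p
  loose⇒cross h nd (H i k) _ p with h k ≤ᵇ i in q | h k ≤ᵇ suc i in r
  ... | true  | false = ⊥-elim (<⇒≱ (≰-of (h k) (suc i) r) (m≤n⇒m≤1+n (≤-of (h k) i q)))
  ... | false | true  = ≤-antisym (≤-of (h k) (suc i) r) (≰-of (h k) i q)
  loose⇒cross h nd (V i k) (_ , k<B) p with h k ≤ᵇ i in q | h (suc k) ≤ᵇ i in r
  ... | true  | false = ≤-of (h k) i q , ≰-of (h (suc k)) i r
  ... | false | true  = ⊥-elim (<⇒≱ (≰-of (h k) i q) (≤-trans (nd k k<B) (≤-of (h (suc k)) i r)))

  -- The vertex drawn by a path crossing `g` is off `g`, so it cannot lie on both `e` and `f`.
  meet-cross : ∀ {e f g} → Valid e → Valid f → Meet e f g →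
               ∀ {h} → NonDecr h → Cross h g → Cross h e ⊎ Cross h f
  meet-cross {e} {f} {g} ve vf m {h} nd c
    with tight (below h) e in eqe | tight (below h) f in eqf
  ... | false | _     = inj₁ (loose⇒cross h nd e ve eqe)
  ... | true  | false = inj₂ (loose⇒cross h nd f vf eqf)
  ... | true  | true  = ⊥-elim (case trans (sym (cross⇒loose h g c)) (m _ (below-mono nd) eqe eqf) of λ ())

  -- The all-true filling, drawn by the path of height 0, is off `bot` and on every other facet. The
  -- all-false filling does the same for `top`.
  ¬meet-bot : ∀ {e f} → Valid e → Valid f → bot ≢ e → bot ≢ f → ¬ Meet e f bot
  ¬meet-bot {e} {f} ve vf n₁ n₂ m = [ none e n₁ , none f n₂ ]′ (meet-cross {g = bot} ve vf m {λ _ → 0} (λ _ _ → z≤n) (refl {x = 0}))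
    where none : ∀ e → bot ≢ e → ¬ Cross (λ _ → 0) e
          none bot n c = n refl
          none (V _ _) n (_ , ())

  ¬meet-top : ∀ {e f} → Valid e → Valid f → top ≢ e → top ≢ f → ¬ Meet e f top
  ¬meet-top {e} {f} ve vf n₁ n₂ m = [ none e ve n₁ , none f vf n₂ ]′ (meet-cross {g = top} ve vf m {λ _ → suc A} (λ _ _ → ≤-refl) ≤-refl)
    where none : ∀ e → Valid e → top ≢ e → ¬ Cross (λ _ → suc A) e
          none top _ n c = n refl
          none (H i k) (i<A , _) n c = <-irrefl (suc-injective (sym c)) i<A
          none (V i k) (i≤A , _) n (c , _) = 1+n≰n (≤-trans c i≤A)

  -- The lattice paths through H i₀ k₀: X is the path before column k₀ and Y the path after it.
  module ThroughH (i₀ k₀ : ℕ) (i₀<A : i₀ < A) (k₀≤B : k₀ ≤ B) where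

    splice : (ℕ → ℕ) → (ℕ → ℕ) → ℕ → ℕ
    splice X Y k with <-cmp k k₀
    ... | tri< _ _ _ = X k
    ... | tri≈ _ _ _ = suc i₀
    ... | tri> _ _ _ = Y k

    splice-< : ∀ {X Y k} → k < k₀ → splice X Y k ≡ X k
    splice-< {k = k} p with <-cmp k k₀
    ... | tri< _ _ _ = refl
    ... | tri≈ q _ _ = ⊥-elim (q p)
    ... | tri> q _ _ = ⊥-elim (q p)

    splice-≡ : ∀ {X Y} → splice X Y k₀ ≡ suc i₀
    splice-≡ with <-cmp k₀ k₀
    ... | tri< _ q _ = ⊥-elim (q refl)
    ... | tri≈ _ _ _ = refl
    ... | tri> _ q _ = ⊥-elim (q refl)

    splice-> : ∀ {X Y k} → k₀ < k → splice X Y k ≡ Y k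
    splice-> {k = k} p with <-cmp k k₀
    ... | tri< _ _ q = ⊥-elim (q p)
    ... | tri≈ _ _ q = ⊥-elim (q p)
    ... | tri> _ _ _ = refl

    record LeftPart : Set where
      field
        height   : ℕ → ℕ
        mono  : ∀ k → suc k < k₀ → height k ≤ height (suc k)
        upper : ∀ k → k < k₀ → height k ≤ suc i₀

    record RightPart : Set where
      field
        height   : ℕ → ℕ
        mono  : ∀ k → k₀ < k → height k ≤ height (suc k)
        lower : ∀ k → k₀ < k → suc i₀ ≤ height k

    path : LeftPart → RightPart → ℕ → ℕ
    path X Y = splice (LeftPart.height X) (RightPart.height Y)

    path-mono : ∀ X Y → NonDecr (path X Y)
    path-mono X Y k _ with <-cmp k k₀ | <-cmp (suc k) k₀
    ... | tri< _ _ _ | tri< p _ _ = LeftPart.mono X k p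
    ... | tri< p _ _ | tri≈ _ _ _ = LeftPart.upper X k p
    ... | tri< p _ _ | tri> _ _ q = ⊥-elim (<⇒≱ q p)
    ... | tri≈ _ refl _ | tri< q _ _ = ⊥-elim (1+n≰n (<⇒≤ q))
    ... | tri≈ _ p _ | tri≈ _ q _ = ⊥-elim (1+n≢n (trans q (sym p)))
    ... | tri≈ _ _ _ | tri> _ _ q = RightPart.lower Y _ q
    ... | tri> _ _ p | tri< q _ _ = ⊥-elim (1+n≰n (≤-trans (<⇒≤ (≤-trans q (n≤1+n _))) p))
    ... | tri> _ _ p | tri≈ _ refl _ = ⊥-elim (1+n≰n (≤-trans (n≤1+n _) p))
    ... | tri> _ _ p | tri> _ _ _ = RightPart.mono Y k p

    -- Test paths arriving at height `suc i₀` in column `k₀`. On the left, `straightˡ` crosses only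
    -- facets `H i₀ k`, and `dropˡ` only facets `V i k` with `suc k ≡ k₀` and `i ≤ i₀`. Among the
    -- latter `stepˡ` crosses only the one with `i ≡ i₀`, while `lateˡ` avoids them all and, among
    -- the `H i₀ k`, crosses only the one next to `H i₀ k₀`. The right parts mirror this.
    straightˡ stepˡ dropˡ lateˡ : LeftPart
    straightˡ = record { height = λ _ → suc i₀ ; mono = λ _ _ → ≤-refl ; upper = λ _ _ → ≤-refl }
    stepˡ     = record { height = λ _ → i₀ ; mono = λ _ _ → ≤-refl ; upper = λ _ _ → n≤1+n _ }
    dropˡ     = record { height = λ _ → 0 ; mono = λ _ _ → z≤n ; upper = λ _ _ → z≤n }
    lateˡ     = record
      { height   = λ k → if does (suc k ≟ k₀) then suc i₀ else 0
      ; mono  = λ k p → subst (λ b → (if b then suc i₀ else 0) ≤ (if does (suc (suc k) ≟ k₀) then suc i₀ else 0)) (sym (dec-false (suc k ≟ k₀) (<⇒≢ p))) z≤n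
      ; upper = λ k _ → bound (does (suc k ≟ k₀)) }
      where bound : ∀ b → (if b then suc i₀ else 0) ≤ suc i₀
            bound true  = ≤-refl
            bound false = z≤n

    straightʳ stepʳ dropʳ lateʳ : RightPart
    straightʳ = record { height = λ _ → suc i₀ ; mono = λ _ _ → ≤-refl ; lower = λ _ _ → ≤-refl }
    stepʳ     = record { height = λ _ → suc (suc i₀) ; mono = λ _ _ → ≤-refl ; lower = λ _ _ → n≤1+n _ }
    dropʳ     = record { height = λ _ → suc A ; mono = λ _ _ → ≤-refl ; lower = λ _ _ → m≤n⇒m≤1+n i₀<A }
    lateʳ     = record
      { height   = λ k → if does (k ≟ suc k₀) then suc i₀ else suc A
      ; mono  = λ k p → subst (λ b → (if does (k ≟ suc k₀) then suc i₀ else suc A) ≤ (if b then suc i₀ else suc A))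
                          (sym (dec-false (suc k ≟ suc k₀) (λ q → <⇒≢ p (sym (suc-injective q))))) (bound′ (does (k ≟ suc k₀)))
      ; lower = λ k _ → bound (does (k ≟ suc k₀)) }
      where bound : ∀ b → suc i₀ ≤ (if b then suc i₀ else suc A)
            bound true  = ≤-refl
            bound false = m≤n⇒m≤1+n i₀<A
            bound′ : ∀ b → (if b then suc i₀ else suc A) ≤ suc A
            bound′ true  = m≤n⇒m≤1+n i₀<A
            bound′ false = ≤-refl

    -- `V i k` sits between columns `k` and `suc k`, so with `k ≡ k₀` it already belongs to the
    -- right part; hence `≤` for `V` against `<` for `H`.
    Left Right : Facet → Set
    Left bot      = ⊥
    Left top      = ⊥
    Left (H i k)  = k < k₀
    Left (V i k)  = k < k₀
    Right bot     = ⊥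
    Right top     = ⊥
    Right (H i k) = k₀ < k
    Right (V i k) = k₀ ≤ k

    -- A nondecreasing path of height `suc i₀` in column `k₀`, where `0 < suc i₀ ≤ A`, neither ends
    -- at height 0 nor starts above `A`; this discards `bot` and `top`.
    side : ∀ X Y e → H i₀ k₀ ≢ e → Cross (path X Y) e → Left e ⊎ Right e
    side X Y bot n c with <-cmp B k₀
    ... | tri< p _ _ = ⊥-elim (<⇒≱ p k₀≤B)
    ... | tri≈ _ _ _ = ⊥-elim (0≢1+n (sym c))
    ... | tri> _ _ p = ⊥-elim (<⇒≱ (RightPart.lower Y B p) (subst (_≤ i₀) (sym c) z≤n))
    side X Y top n c with <-cmp 0 k₀
    ... | tri< p _ _ = ⊥-elim (<⇒≱ c (≤-trans (LeftPart.upper X 0 p) i₀<A))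
    ... | tri≈ _ _ _ = ⊥-elim (<⇒≱ c i₀<A)
    side X Y (H i k) n c with <-cmp k k₀
    ... | tri< p _ _ = inj₁ p
    ... | tri≈ _ refl _ = ⊥-elim (n (cong (λ j → H j k) (suc-injective c)))
    ... | tri> _ _ p = inj₂ p
    side X Y (V i k) n c with k <? k₀
    ... | yes p = inj₁ p
    ... | no p  = inj₂ (≮⇒≥ p)

    IsHˡ IsVˡ IsHʳ IsVʳ : Facet → Set
    IsHˡ e = ∃ λ k → k < k₀ × e ≡ H i₀ k
    IsVˡ e = ∃ λ i → ∃ λ k → i ≤ i₀ × suc k ≡ k₀ × e ≡ V i k
    IsHʳ e = ∃ λ k → k₀ < k × e ≡ H i₀ k
    IsVʳ e = ∃ λ i → suc i₀ ≤ i × e ≡ V i k₀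

    leftNext : ∀ X Y k → k < k₀ → splice X Y (suc k) ≡ X (suc k) ⊎ (suc k ≡ k₀ × splice X Y (suc k) ≡ suc i₀)
    leftNext X Y k k<k₀ with m≤n⇒m<n∨m≡n k<k₀
    ... | inj₁ p    = inj₁ (splice-< p)
    ... | inj₂ refl = inj₂ (refl , splice-≡)

    straightˡ⇒H : ∀ Y e → Left e → Cross (path straightˡ Y) e → IsHˡ e
    straightˡ⇒H Y (H i k) l c = k , l , cong (λ j → H j k) (sym (suc-injective (trans (sym (splice-< l)) c)))
    straightˡ⇒H Y (V i k) l (c , d) rewrite splice-< {λ _ → suc i₀} {RightPart.height Y} l
      with leftNext (λ _ → suc i₀) (RightPart.height Y) k l
    ... | inj₁ p       rewrite p = ⊥-elim (<⇒≱ d c)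
    ... | inj₂ (_ , p) rewrite p = ⊥-elim (<⇒≱ d c)

    dropˡ⇒V : ∀ Y e → Left e → Cross (path dropˡ Y) e → IsVˡ e
    dropˡ⇒V Y (H i k) l c = ⊥-elim (0≢1+n (trans (sym (splice-< l)) c))
    dropˡ⇒V Y (V i k) l (c , d) with leftNext (λ _ → 0) (RightPart.height Y) k l
    ... | inj₁ p       rewrite p = ⊥-elim (<⇒≱ d z≤n)
    ... | inj₂ (q , p) rewrite p = i , k , s≤s⁻¹ d , q , refl

    H-stepˡ : ∀ Y {e} → IsHˡ e → ¬ Cross (path stepˡ Y) e
    H-stepˡ Y (k , p , refl) c = 1+n≢n (sym (trans (sym (splice-< p)) c))

    V-stepˡ : ∀ Y {i k} → suc k ≡ k₀ → i ≤ i₀ → Cross (path stepˡ Y) (V i k) → i ≡ i₀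
    V-stepˡ Y {k = k} refl p (c , _) = ≤-antisym p (subst (_≤ _) (splice-< {λ _ → i₀} {RightPart.height Y} (n<1+n k)) c)

    H-dropˡ : ∀ Y {e} → IsHˡ e → ¬ Cross (path dropˡ Y) e
    H-dropˡ Y (k , p , refl) c = 0≢1+n (trans (sym (splice-< p)) c)

    H-lateˡ : ∀ Y {k} → k < k₀ → Cross (path lateˡ Y) (H i₀ k) → suc k ≡ k₀
    H-lateˡ Y {k} p c with suc k ≟ k₀
    ... | yes q = q
    ... | no q  = ⊥-elim (0≢1+n (trans (sym (trans (splice-< {LeftPart.height lateˡ} {RightPart.height Y} p)
                    (cong (λ b → if b then suc i₀ else 0) (dec-false (suc k ≟ k₀) q)))) c))

    V-lateˡ : ∀ Y {e} → IsVˡ e → ¬ Cross (path lateˡ Y) e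
    V-lateˡ Y (i , k , p , refl , refl) (c , _) =
      1+n≰n (≤-trans (subst (_≤ i) (trans (splice-< {LeftPart.height lateˡ} {RightPart.height Y} (n<1+n k))
        (cong (λ b → if b then suc i₀ else 0) (dec-true (suc k ≟ suc k) refl))) c) p)

    rightHere : ∀ X Y k → k₀ ≤ k → (k ≡ k₀ × splice X Y k ≡ suc i₀) ⊎ splice X Y k ≡ Y k
    rightHere X Y k p with m≤n⇒m<n∨m≡n p
    ... | inj₁ q    = inj₂ (splice-> q)
    ... | inj₂ refl = inj₁ (refl , splice-≡)

    straightʳ⇒H : ∀ X e → Right e → Cross (path X straightʳ) e → IsHʳ e
    straightʳ⇒H X (H i k) r c = k , r , cong (λ j → H j k) (sym (suc-injective (trans (sym (splice-> r)) c)))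
    straightʳ⇒H X (V i k) r (c , d) rewrite splice-> {LeftPart.height X} {λ _ → suc i₀} (s≤s r)
      with rightHere (LeftPart.height X) (λ _ → suc i₀) k r
    ... | inj₁ (_ , p) rewrite p = ⊥-elim (<⇒≱ d c)
    ... | inj₂ p       rewrite p = ⊥-elim (<⇒≱ d c)

    dropʳ⇒V : ∀ X e → Valid e → Right e → Cross (path X dropʳ) e → IsVʳ e
    dropʳ⇒V X (H i k) (i<A , _) r c = ⊥-elim (<-irrefl (suc-injective (trans (sym c) (splice-> r))) i<A)
    dropʳ⇒V X (V i k) (i≤A , _) r (c , d) with rightHere (LeftPart.height X) (λ _ → suc A) k r
    ... | inj₁ (refl , p) = i , subst (_≤ i) p c , refl
    ... | inj₂ p          = ⊥-elim (1+n≰n (≤-trans (subst (_≤ i) p c) i≤A))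

    H-stepʳ : ∀ X {e} → IsHʳ e → ¬ Cross (path X stepʳ) e
    H-stepʳ X (k , p , refl) c = 1+n≢n (trans (sym (splice-> p)) c)

    V-stepʳ : ∀ X {i} → suc i₀ ≤ i → Cross (path X stepʳ) (V i k₀) → i ≡ suc i₀
    V-stepʳ X {i} p (_ , d) = ≤-antisym (s≤s⁻¹ (subst (i <_) (splice-> {LeftPart.height X} {λ _ → suc (suc i₀)} (n<1+n k₀)) d)) p

    H-dropʳ : ∀ X {e} → Valid e → IsHʳ e → ¬ Cross (path X dropʳ) e
    H-dropʳ X _ (k , p , refl) c = <-irrefl (suc-injective (trans (sym c) (splice-> p))) i₀<A

    H-lateʳ : ∀ X {k} → k₀ < k → Cross (path X lateʳ) (H i₀ k) → k ≡ suc k₀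
    H-lateʳ X {k} p c with k ≟ suc k₀
    ... | yes q = q
    ... | no q  = ⊥-elim (<-irrefl (suc-injective (trans (sym c) (trans (splice-> {LeftPart.height X} {RightPart.height lateʳ} p)
                    (cong (λ b → if b then suc i₀ else suc A) (dec-false (k ≟ suc k₀) q))))) i₀<A)

    V-lateʳ : ∀ X {e} → IsVʳ e → ¬ Cross (path X lateʳ) e
    V-lateʳ X (i , p , refl) (_ , d) =
      <⇒≱ (subst (i <_) (trans (splice-> {LeftPart.height X} {RightPart.height lateʳ} (n<1+n k₀))
        (cong (λ b → if b then suc i₀ else suc A) (dec-true (suc k₀ ≟ suc k₀) refl))) d) p

    module _ {e f} (ve : Valid e) (vf : Valid f) (n₁ : H i₀ k₀ ≢ e) (n₂ : H i₀ k₀ ≢ f)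
             (hit : ∀ X Y → Cross (path X Y) e ⊎ Cross (path X Y) f) where

      private
        other : ∀ X Y → ¬ Cross (path X Y) e → Cross (path X Y) f
        other X Y n with hit X Y
        ... | inj₁ c = ⊥-elim (n c)
        ... | inj₂ c = c

        first : ∀ X Y → ¬ Cross (path X Y) f → Cross (path X Y) e
        first X Y n with hit X Y
        ... | inj₁ c = c
        ... | inj₂ c = ⊥-elim (n c)

      -- Every path through `dropˡ` or `stepˡ` avoids `e` and must cross `f`. Dropping on both sides
      -- shows that `f` is not on the right, so it is a `V` in the column just before `k₀`; `stepˡ`
      -- then fixes its row. As `lateˡ` avoids this `f`, it must cross `e`, which puts `e` in the
      -- same column. The result is the near pair of the square in which `H i₀ k₀` is a far side.
      fromLeft : IsHˡ e → Opp e f (H i₀ k₀)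
      fromLeft he@(k , k<k₀ , refl) with side dropˡ straightʳ f n₂ (other dropˡ straightʳ (H-dropˡ straightʳ he))
      ... | inj₂ r with straightʳ⇒H dropˡ f r (other dropˡ straightʳ (H-dropˡ straightʳ he))
      ...   | hf = ⊥-elim (H-dropʳ dropˡ vf hf (other dropˡ dropʳ (H-dropˡ dropʳ he)))
      fromLeft he@(k , k<k₀ , refl) | inj₁ l with dropˡ⇒V straightʳ f l (other dropˡ straightʳ (H-dropˡ straightʳ he))
      ...   | hf@(i , k′ , i≤i₀ , q , refl)
              with V-stepˡ straightʳ q i≤i₀ (other stepˡ straightʳ (H-stepˡ straightʳ he))
                 | H-lateˡ straightʳ k<k₀ (first lateˡ straightʳ (V-lateˡ straightʳ hf))
      ...      | refl | refl with suc-injective q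
      ...         | refl = nearHV i₀<A k₀≤B (inj₁ refl)

      -- The mirror image: here `e` and `f` become the far pair of the square in which `H i₀ k₀` is
      -- a near side.
      fromRight : IsHʳ e → Opp e f (H i₀ k₀)
      fromRight he@(k , k₀<k , refl) with side straightˡ dropʳ f n₂ (other straightˡ dropʳ (H-dropʳ straightˡ ve he))
      ... | inj₁ l with straightˡ⇒H dropʳ f l (other straightˡ dropʳ (H-dropʳ straightˡ ve he))
      ...   | hf = ⊥-elim (H-dropˡ dropʳ hf (other dropˡ dropʳ (H-dropʳ dropˡ ve he)))
      fromRight he@(k , k₀<k , refl) | inj₂ r with dropʳ⇒V straightˡ f vf r (other straightˡ dropʳ (H-dropʳ straightˡ ve he))
      ...   | hf@(i , i₀<i , refl)
              with V-stepʳ straightˡ i₀<i (other straightˡ stepʳ (H-stepʳ straightˡ he))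
                 | H-lateʳ straightˡ k₀<k (first straightˡ lateʳ (V-lateʳ straightˡ hf))
      ...      | refl | refl = farHV i₀<A (proj₂ ve) (inj₁ refl)

      fromFirst : Cross (path straightˡ straightʳ) e → Opp e f (H i₀ k₀)
      fromFirst c with side straightˡ straightʳ e n₁ c
      ... | inj₁ l = fromLeft (straightˡ⇒H straightʳ e l c)
      ... | inj₂ r = fromRight (straightʳ⇒H straightˡ e r c)

    -- The straight path crosses nothing but facets `H i₀ k`, so one of `e` and `f` has this form;
    -- both may take that part by symmetry.
    classify-H : ∀ {e f} → Valid e → Valid f → H i₀ k₀ ≢ e → H i₀ k₀ ≢ f → Meet e f (H i₀ k₀) → Opp e f (H i₀ k₀)
    classify-H {e} {f} ve vf n₁ n₂ m = [ fromFirst ve vf n₁ n₂ hit , (λ c → Opp-sym (fromFirst vf ve n₂ n₁ (λ X Y → swap (hit X Y)) c)) ]′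
                                        (hit straightˡ straightʳ)
      where hit : ∀ X Y → Cross (path X Y) e ⊎ Cross (path X Y) f
            hit X Y = meet-cross {g = H i₀ k₀} ve vf m (path-mono X Y) splice-≡

-- Transposition of the grid

κ : Facet → Facet
κ bot     = top
κ top     = bot
κ (H i k) = V k i
κ (V i k) = H k i

κ-involutive : ∀ e → κ (κ e) ≡ e
κ-involutive bot     = refl
κ-involutive top     = refl
κ-involutive (H _ _) = refl
κ-involutive (V _ _) = refl

-- Transposing alone would reverse the order in both directions; the complement restores it.
flip : Filling → Filling
flip v i k = not (v k i)

not-true : ∀ {x} → not x ≡ true → x ≡ false
not-true {false} _ = refl

not-anti : ∀ {x y} → (x ≡ true → y ≡ true) → not y ≡ true → not x ≡ true
not-anti {false}         _ _ = refl
not-anti {true}  {true}  _ p = p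
not-anti {true}  {false} f p = f refl

eqb-not : ∀ x y → eqb (not x) (not y) ≡ eqb x y
eqb-not false false = refl
eqb-not false true  = refl
eqb-not true  false = refl
eqb-not true  true  = refl

module _ (A B : ℕ) where

  κ-valid : ∀ {e} → Valid A B e → Valid B A (κ e)
  κ-valid {bot}   _       = tt
  κ-valid {top}   _       = tt
  κ-valid {H i k} (p , q) = q , p
  κ-valid {V i k} (p , q) = q , p

  flip-mono : ∀ {v} → Monotone A B v → Monotone B A (flip v)
  flip-mono {v} (m₁ , m₂) = (λ i k p q → not-anti (m₂ k i q p)) , λ i k p q → not-anti (m₁ k i q p)

  flip-tight : ∀ v e → tight B A (flip v) (κ e) ≡ tight A B v e
  flip-tight v bot     = refl
  flip-tight v top     = not-involutive (v A 0)
  flip-tight v (H i k) = eqb-not (v i k) (v (suc i) k)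
  flip-tight v (V i k) = eqb-not (v i k) (v i (suc k))

  κ-opp : ∀ {e f g} → Opp A B e f g → Opp B A (κ e) (κ f) (κ g)
  κ-opp (nearHV p q (inj₁ refl)) = nearVH q p (inj₂ refl)
  κ-opp (nearHV p q (inj₂ refl)) = nearVH q p (inj₁ refl)
  κ-opp (nearVH p q (inj₁ refl)) = nearHV q p (inj₂ refl)
  κ-opp (nearVH p q (inj₂ refl)) = nearHV q p (inj₁ refl)
  κ-opp (farHV p q (inj₁ refl))  = farVH q p (inj₂ refl)
  κ-opp (farHV p q (inj₂ refl))  = farVH q p (inj₁ refl)
  κ-opp (farVH p q (inj₁ refl))  = farHV q p (inj₂ refl)
  κ-opp (farVH p q (inj₂ refl))  = farHV q p (inj₁ refl)

module _ (A B : ℕ) where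

  flip-tightᵗ : ∀ v e → tight A B (flip v) e ≡ tight B A v (κ e)
  flip-tightᵗ v e = trans (cong (tight A B (flip v)) (sym (κ-involutive e))) (flip-tight B A v (κ e))

  κ-meet : ∀ {e f g} → Meet A B e f g → Meet B A (κ e) (κ f) (κ g)
  κ-meet {e} {f} {g} m v mv p q = trans (sym (flip-tightᵗ v g)) (m (flip v) (flip-mono B A mv) (trans (flip-tightᵗ v e) p) (trans (flip-tightᵗ v f) q))

κ-inj : ∀ {e f} → κ e ≡ κ f → e ≡ f
κ-inj {e} {f} p = trans (sym (κ-involutive e)) (trans (cong κ p) (κ-involutive f))

κ-opp⁻ : ∀ {A B e f g} → Opp B A (κ e) (κ f) (κ g) → Opp A B e f g
κ-opp⁻ {A} {B} {e} {f} {g} o = subst₂ (λ x (y : Facet × Facet) → Opp A B x (proj₁ y) (proj₂ y)) (κ-involutive e)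
  (cong₂ _,_ (κ-involutive f) (κ-involutive g)) (κ-opp B A o)

classify : ∀ A B {e f g} → Valid A B e → Valid A B f → Valid A B g → g ≢ e → g ≢ f → Meet A B e f g → Opp A B e f g
classify A B {g = bot}   ve vf vg n₁ n₂ m = ⊥-elim (¬meet-bot A B ve vf n₁ n₂ m)
classify A B {g = top}   ve vf vg n₁ n₂ m = ⊥-elim (¬meet-top A B ve vf n₁ n₂ m)
classify A B {g = H i k} ve vf (p , q) n₁ n₂ m = ThroughH.classify-H A B i k p q ve vf n₁ n₂ m
classify A B {e} {f} {g = V i k} ve vf (p , q) n₁ n₂ m =
  κ-opp⁻ (ThroughH.classify-H B A k i q p (κ-valid A B ve) (κ-valid A B vf) (n₁ ∘ κ-inj) (n₂ ∘ κ-inj) (κ-meet A B {e} {f} {V i k} m))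

eqb⇒≡ : ∀ {x y} → eqb x y ≡ true → x ≡ y
eqb⇒≡ {false} {false} _ = refl
eqb⇒≡ {true}  {true}  _ = refl

eqb-refl : ∀ x → eqb x x ≡ true
eqb-refl false = refl
eqb-refl true  = refl

≡⇒eqb : ∀ {x y} → x ≡ y → eqb x y ≡ true
≡⇒eqb {x} refl = eqb-refl x

sandwich : ∀ {x y z} → (x ≡ true → y ≡ true) → (y ≡ true → z ≡ true) → x ≡ z → y ≡ x
sandwich {true}          f g refl = f refl
sandwich {false} {false} f g refl = refl
sandwich {false} {true}  f g refl = sym (g refl)

-- Equality along one chain makes the least and greatest entries of the square agree, and
-- monotonicity squeezes the remaining entry between them.
opp⇒meet : ∀ A B {e f g} → Opp A B e f g → Meet A B e f g
opp⇒meet A B {e} {f} {g} o v (m₁ , m₂) = go o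
  where
  near : ∀ {g} i k → i < A → k < B → g ≡ H i (suc k) ⊎ g ≡ V (suc i) k →
         v i k ≡ v (suc i) k → v i k ≡ v i (suc k) → tight A B v g ≡ true
  near i k p q r s t with sandwich (m₁ i (suc k) p q) (m₂ (suc i) k p q) (trans (sym t) s)
  near i k p q (inj₁ refl) s t | u = ≡⇒eqb (sym u)
  near i k p q (inj₂ refl) s t | u = ≡⇒eqb (trans (sym s) (trans t (sym u)))

  far : ∀ {g} i k → i < A → k < B → g ≡ H i k ⊎ g ≡ V i k →
        v i (suc k) ≡ v (suc i) (suc k) → v (suc i) k ≡ v (suc i) (suc k) → tight A B v g ≡ true
  far i k p q r s t with sandwich (m₂ i k (<⇒≤ p) q) (m₁ i k p (<⇒≤ q)) (trans s (sym t))
  far i k p q (inj₁ refl) s t | u = ≡⇒eqb (trans u (trans s (sym t)))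
  far i k p q (inj₂ refl) s t | u = ≡⇒eqb u

  go : ∀ {e f g} → Opp A B e f g → tight A B v e ≡ true → tight A B v f ≡ true → tight A B v g ≡ true
  go (nearHV {i} {k} p q r) s t = near i k p q r (eqb⇒≡ s) (eqb⇒≡ t)
  go (nearVH {i} {k} p q r) t s = near i k p q r (eqb⇒≡ s) (eqb⇒≡ t)
  go (farHV {i} {k} p q r) s t  = far i k p q r (eqb⇒≡ s) (eqb⇒≡ t)
  go (farVH {i} {k} p q r) t s  = far i k p q r (eqb⇒≡ s) (eqb⇒≡ t)

-- Rigidity of the pairing on facets

-- `Pair` preserves `i + k`. On the antidiagonal `i + k = d` it is adjacency in the path `V 0 d`,
-- `H 0 d`, `V 1 (d - 1)`, `H 1 (d - 1)`, and so on, restricted to the valid facets. In particular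
-- each facet has at most two partners.
data Pair (A B : ℕ) : Facet → Facet → Set where
  nearHV : ∀ {i k} → i < A → k < B → Pair A B (H i k) (V i k)
  nearVH : ∀ {i k} → i < A → k < B → Pair A B (V i k) (H i k)
  farHV  : ∀ {i k} → i < A → k < B → Pair A B (H i (suc k)) (V (suc i) k)
  farVH  : ∀ {i k} → i < A → k < B → Pair A B (V (suc i) k) (H i (suc k))

module _ {A B : ℕ} where

  opp⇒pair : ∀ {e f g} → Opp A B e f g → Pair A B e f
  opp⇒pair (nearHV p q _) = nearHV p q
  opp⇒pair (nearVH p q _) = nearVH p q
  opp⇒pair (farHV p q _)  = farHV p q
  opp⇒pair (farVH p q _)  = farVH p q

  pair⇒opp : ∀ {e f} → Pair A B e f → ∃ (Opp A B e f)
  pair⇒opp (nearHV p q) = _ , nearHV p q (inj₁ refl)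
  pair⇒opp (nearVH p q) = _ , nearVH p q (inj₁ refl)
  pair⇒opp (farHV p q)  = _ , farHV p q (inj₁ refl)
  pair⇒opp (farVH p q)  = _ , farVH p q (inj₁ refl)

  pair-sym : ∀ {e f} → Pair A B e f → Pair A B f e
  pair-sym (nearHV p q) = nearVH p q
  pair-sym (nearVH p q) = nearHV p q
  pair-sym (farHV p q)  = farVH p q
  pair-sym (farVH p q)  = farHV p q

  pair-valid : ∀ {e f} → Pair A B e f → Valid A B f
  pair-valid (nearHV p q) = <⇒≤ p , q
  pair-valid (nearVH p q) = p , <⇒≤ q
  pair-valid (farHV p q)  = p , q
  pair-valid (farVH p q)  = p , q

  pair-H : ∀ {i k f} → Pair A B (H i k) f → f ≡ V i k ⊎ ∃ λ k′ → k ≡ suc k′ × f ≡ V (suc i) k′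
  pair-H (nearHV _ _) = inj₁ refl
  pair-H (farHV _ _)  = inj₂ (_ , refl , refl)

  pair-V : ∀ {i k f} → Pair A B (V i k) f → f ≡ H i k ⊎ ∃ λ i′ → i ≡ suc i′ × f ≡ H i′ (suc k)
  pair-V (nearVH _ _) = inj₁ refl
  pair-V (farVH _ _)  = inj₂ (_ , refl , refl)

  opp-near : ∀ {i k g} → Opp A B (H i k) (V i k) g → (i < A × k < B) × (g ≡ H i (suc k) ⊎ g ≡ V (suc i) k)
  opp-near (nearHV p q r) = (p , q) , r

-- Two grids are allowed so that an automorphism followed by `κ` is also an instance, with the
-- transposed grid as target.
record Iso (A B A′ B′ : ℕ) : Set where
  field
    to from    : Facet → Facet
    to-valid   : ∀ {e} → Valid A B e → Valid A′ B′ (to e)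
    from-valid : ∀ {e} → Valid A′ B′ e → Valid A B (from e)
    from-to    : ∀ {e} → Valid A B e → from (to e) ≡ e
    to-from    : ∀ {e} → Valid A′ B′ e → to (from e) ≡ e
    to-opp     : ∀ {e f g} → Opp A B e f g → Opp A′ B′ (to e) (to f) (to g)
    from-opp   : ∀ {e f g} → Opp A′ B′ e f g → Opp A B (from e) (from f) (from g)

  to-pair : ∀ {e f} → Pair A B e f → Pair A′ B′ (to e) (to f)
  to-pair p = opp⇒pair (to-opp (proj₂ (pair⇒opp p)))

  from-pair : ∀ {e f} → Pair A′ B′ e f → Pair A B (from e) (from f)
  from-pair p = opp⇒pair (from-opp (proj₂ (pair⇒opp p)))

  injective : ∀ {e f} → Valid A B e → Valid A B f → to e ≡ to f → e ≡ f
  injective ve vf p = trans (sym (from-to ve)) (trans (cong from p) (from-to vf))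

κ-conj : ∀ {A B A′ B′} → Iso A B A′ B′ → Iso B A B′ A′
κ-conj {A} {B} {A′} {B′} I = record
  { to = κ ∘ to ∘ κ ; from = κ ∘ from ∘ κ
  ; to-valid   = κ-valid A′ B′ ∘ to-valid ∘ κ-valid B A
  ; from-valid = κ-valid A B ∘ from-valid ∘ κ-valid B′ A′
  ; from-to = λ {e} v → trans (cong (κ ∘ from) (κ-involutive (to (κ e)))) (trans (cong κ (from-to (κ-valid B A v))) (κ-involutive e))
  ; to-from = λ {e} v → trans (cong (κ ∘ to) (κ-involutive (from (κ e)))) (trans (cong κ (to-from (κ-valid B′ A′ v))) (κ-involutive e))
  ; to-opp   = κ-opp A′ B′ ∘ to-opp ∘ κ-opp B A
  ; from-opp = κ-opp A B ∘ from-opp ∘ κ-opp B′ A′ }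
  where open Iso I

module _ {A B A′ B′ : ℕ} (I : Iso A B A′ B′) where
  open Iso I

  Fixes : Facet → Set
  Fixes e = to e ≡ e

  from-fixed : ∀ {e} → Valid A B e → Fixes e → from e ≡ e
  from-fixed v p = trans (cong from (sym p)) (from-to v)

  -- Only the two far sides contain the intersection of the near pair, so a map fixing the near pair
  -- keeps the far sides among themselves. The first component records that this square also exists
  -- in the target.
  near⇒far : ∀ {i k} → i < A → k < B → Fixes (H i k) → Fixes (V i k) →
             (i < A′ × k < B′)
             × (to (H i (suc k)) ≡ H i (suc k) ⊎ to (H i (suc k)) ≡ V (suc i) k)
             × (to (V (suc i) k) ≡ H i (suc k) ⊎ to (V (suc i) k) ≡ V (suc i) k)
  near⇒far {i} {k} p q h v = proj₁ (opp-near (image (inj₁ refl)))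
                           , proj₂ (opp-near (image (inj₁ refl)))
                           , proj₂ (opp-near (image (inj₂ refl)))
    where image : ∀ {g} → g ≡ H i (suc k) ⊎ g ≡ V (suc i) k → Opp A′ B′ (H i k) (V i k) (to g)
          image {g} r = subst₂ (λ x y → Opp A′ B′ x y (to g)) h v (to-opp (nearHV p q r))

  far-fixed : ∀ {i k} → i < A → k < B → Fixes (H i k) → Fixes (V i k) → Fixes (H i (suc k)) ⊎ Fixes (V (suc i) k) →
              Fixes (H i (suc k)) × Fixes (V (suc i) k)
  far-fixed p q h v (inj₁ f) with proj₂ (proj₂ (near⇒far p q h v))
  ... | inj₂ r = f , r
  ... | inj₁ r with injective (p , q) (p , q) (trans r (sym f))
  ...   | ()
  far-fixed p q h v (inj₂ f) with proj₁ (proj₂ (near⇒far p q h v))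
  ... | inj₁ r = r , f
  ... | inj₂ r with injective (p , q) (p , q) (trans r (sym f))
  ...   | ()

  -- The image of `V i (suc k)` is a partner of the fixed facet `H i (suc k)`. One of its two
  -- possible partners, `V (suc i) k`, is already the image of itself.
  next-V : ∀ {i k} → i < A → suc k < B → Fixes (H i (suc k)) → Fixes (V (suc i) k) → Fixes (V i (suc k))
  next-V {i} {k} p q h v with pair-H (subst (λ x → Pair A′ B′ x (to (V i (suc k)))) h (to-pair (nearHV p q)))
  ... | inj₁ r = r
  ... | inj₂ (_ , refl , r) with injective (<⇒≤ p , q) (p , <-trans (n<1+n _) q) (trans r (sym v))
  ...   | ()

  -- The far pairs of two squares on one antidiagonal are linked by a pair, which tells the facets of each apart.
  adjacent-far : ∀ {i k} → suc i < A → suc k < B →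
    Fixes (H i (suc k)) → Fixes (V i (suc k)) → Fixes (H (suc i) k) → Fixes (V (suc i) k) →
    Fixes (V (suc i) (suc k)) × Fixes (H (suc i) (suc k))
  adjacent-far {i} {k} p q h₁ v₁ h₂ v₂
    with to (V (suc i) (suc k)) | proj₂ (proj₂ (near⇒far (<-trans (n<1+n _) p) q h₁ v₁))
       | to (H (suc i) (suc k)) | proj₁ (proj₂ (near⇒far p (<-trans (n<1+n _) q) h₂ v₂)) | to-pair (nearHV p q)
  ... | _ | inj₂ refl | _ | inj₁ refl | _ = refl , refl
  ... | _ | inj₁ refl | _ | inj₁ refl | ()
  ... | _ | inj₂ refl | _ | inj₂ refl | ()
  ... | _ | inj₁ refl | _ | inj₂ refl | ()

  -- In a strip an antidiagonal has no second square with which to compare the far pair. An exchange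
  -- is refuted instead through `V 0 (suc (suc k))`, the other partner of `H 0 (suc (suc k))`, which
  -- exists by the bound on `B`.
  strip-far : ∀ {k} → A ≡ 1 → suc (suc k) < B → Fixes (H 0 (suc k)) → Fixes (V 0 (suc k)) → Fixes (V 1 k) →
              Fixes (H 0 (suc (suc k))) × Fixes (V 1 (suc k))
  strip-far {k} refl q h v v′ = far-fixed ≤-refl q₁ h v (fixes (proj₁ (proj₂ nf)))
    where
    q₁ = <-trans (n<1+n _) q
    nf = near⇒far ≤-refl q₁ h v

    -- A tilted image forces a second column in the target, giving V 1 k a second partner there.
    fixes : to (H 0 (suc (suc k))) ≡ H 0 (suc (suc k)) ⊎ to (H 0 (suc (suc k))) ≡ V 1 (suc k) →
            Fixes (H 0 (suc (suc k))) ⊎ Fixes (V 1 (suc k))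
    fixes (inj₁ r) = inj₁ r
    fixes (inj₂ r) with proj₂ (proj₂ nf)
    ... | inj₂ s = inj₂ s
    ... | inj₁ s with pair-V (subst (λ x → Pair A′ B′ x (to (V 0 (suc (suc k))))) r (to-pair (nearHV ≤-refl q)))
    ...   | inj₂ (_ , refl , t) with injective {V 0 (suc (suc k))} {V 1 (suc k)} (z≤n , q) (≤-refl , q₁) (trans t (sym s))
    ...     | ()
    fixes (inj₂ r) | inj₁ s | inj₁ t = ⊥-elim (clash (pair-V (subst (λ x → Pair 1 B x (from (H 1 k))) (from-fixed (≤-refl , <⇒≤ q₁) v′)
                                         (from-pair (nearVH 1<A′ k<B′)))))
      where
      1<A′ : 1 < A′
      1<A′ = proj₁ (subst (Valid A′ B′) t (to-valid {V 0 (suc (suc k))} (z≤n , q)))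
      k<B′ : k < B′
      k<B′ = <-trans (n<1+n _) (proj₂ (proj₁ nf))
      clash : ¬ (from (H 1 k) ≡ H 1 k ⊎ ∃ λ i′ → 1 ≡ suc i′ × from (H 1 k) ≡ H i′ (suc k))
      clash (inj₁ u) = 1+n≰n (proj₁ (subst (Valid 1 B) u (from-valid (1<A′ , <⇒≤ k<B′))))
      clash (inj₂ (_ , refl , u)) with trans (sym (to-from (1<A′ , <⇒≤ k<B′))) (trans (cong to u) h)
      ... | ()

  Level : ℕ → Set
  Level d = ∀ i k → i + k ≡ d → (Valid A B (H i k) → Fixes (H i k)) × (Valid A B (V i k) → Fixes (V i k))

module _ {A B A′ B′ : ℕ} (I : Iso A B A′ B′) where

  private
    Iᵗ = κ-conj I

  κ-fixes : ∀ {e} → Fixes I e → Fixes Iᵗ (κ e)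
  κ-fixes {e} p = cong κ (trans (cong (Iso.to I) (κ-involutive e)) p)

  κ-fixes⁻ : ∀ {e} → Fixes Iᵗ (κ e) → Fixes I e
  κ-fixes⁻ {e} p = trans (cong (Iso.to I) (sym (κ-involutive e))) (κ-inj p)

  next-H : ∀ {i k} → suc i < A → k < B → Fixes I (H i (suc k)) → Fixes I (V (suc i) k) → Fixes I (H (suc i) k)
  next-H p q h v = κ-fixes⁻ (next-V Iᵗ q p (κ-fixes v) (κ-fixes h))

  -- The bound says that `(i , k)` is not the last square `(A - 1 , B - 1)`. Since `i + k` is
  -- positive, a neighbouring square on the antidiagonal then exists for `adjacent-far`, unless the
  -- grid is a strip, where `strip-far` applies.
  far-level : ∀ {d} → Level I (suc d) → 3 + suc d ≤ A + B → ∀ i k → i + k ≡ suc d → i < A → k < B →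
              Fixes I (H i (suc k)) × Fixes I (V (suc i) k)
  far-level l b zero (suc k) refl p q = done
    where
    h = proj₁ (l 0 (suc k) refl) (p , <⇒≤ q)
    v = proj₂ (l 0 (suc k) refl) (z≤n , q)
    q′ = <-trans (n<1+n _) q
    done : Fixes I (H 0 (suc (suc k))) × Fixes I (V 1 (suc k))
    done with 1 <? A
    ... | yes r = far-fixed I p q h v (inj₂ (proj₁ (adjacent-far I r q h v
                    (proj₁ (l 1 k refl) (r , <⇒≤ q′)) (proj₂ (l 1 k refl) (p , q′)))))
    ... | no r with ≤-antisym (≮⇒≥ r) p
    ...   | refl = strip-far I refl (s≤s⁻¹ b) h v (proj₂ (l 1 k refl) (≤-refl , q′))
  far-level l b (suc i) zero refl p q = done
    where
    h = proj₁ (l (suc i) 0 refl) (p , <⇒≤ q)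
    v = proj₂ (l (suc i) 0 refl) (<⇒≤ p , q)
    p′ = <-trans (n<1+n _) p
    done : Fixes I (H (suc i) 1) × Fixes I (V (suc (suc i)) 0)
    done with 1 <? B
    ... | yes r = far-fixed I p q h v (inj₁ (proj₂ (adjacent-far I p r
                    (proj₁ (l i 1 (+-suc i 0)) (p′ , q)) (proj₂ (l i 1 (+-suc i 0)) (<⇒≤ p′ , r)) h v)))
    ... | no r with ≤-antisym (≮⇒≥ r) q
    ...   | refl with strip-far Iᵗ refl bound (κ-fixes v) (κ-fixes h) (κ-fixes (proj₁ (l i 1 (+-suc i 0)) (p′ , q)))
      where bound : suc (suc i) < A
            bound = s≤s⁻¹ (subst₂ _≤_ (cong (4 +_) (+-identityʳ i)) (+-comm A 1) b)
    ...     | x , y = κ-fixes⁻ y , κ-fixes⁻ x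
  far-level l b (suc i) (suc k) refl p q = done
    where
    h = proj₁ (l (suc i) (suc k) refl) (p , <⇒≤ q)
    v = proj₂ (l (suc i) (suc k) refl) (<⇒≤ p , q)
    p′ = <-trans (n<1+n _) p
    q′ = <-trans (n<1+n _) q
    e₁ = +-suc i (suc k)
    e₂ = cong suc (sym (+-suc i k))
    done : Fixes I (H (suc i) (suc (suc k))) × Fixes I (V (suc (suc i)) (suc k))
    done with suc (suc k) <? B
    ... | yes r = far-fixed I p q h v (inj₁ (proj₂ (adjacent-far I p r
                    (proj₁ (l i (suc (suc k)) e₁) (p′ , q)) (proj₂ (l i (suc (suc k)) e₁) (<⇒≤ p′ , r)) h v)))
    ... | no r with suc (suc i) <? A
    ...   | yes s = far-fixed I p q h v (inj₂ (proj₁ (adjacent-far I s q h v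
                    (proj₁ (l (suc (suc i)) k e₂) (s , <⇒≤ q′)) (proj₂ (l (suc (suc i)) k e₂) (p , q′)))))
    ...   | no s = ⊥-elim (1+n≰n (≤-trans b (subst (A + B ≤_) (cong (2 +_) e₁) (+-mono-≤ (≮⇒≥ s) (≮⇒≥ r)))))

  next-level : ∀ {d} → 0 < A → 0 < B → Level I (suc d) → 3 + suc d ≤ A + B → Level I (suc (suc d))
  next-level {d} 0<A 0<B l b i k p = horiz i k p , vert i k p
    where
    horiz : ∀ i k → i + k ≡ suc (suc d) → Valid A B (H i k) → Fixes I (H i k)
    horiz i (suc k) p (x , y) = proj₁ (far-level l b i k (suc-injective (trans (sym (+-suc i k)) p)) x y)
    horiz i zero p (x , y) with trans (sym (+-identityʳ i)) p
    ... | refl with far-level l b (suc d) 0 (+-identityʳ _) (<-trans (n<1+n _) x) 0<B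
    ...   | h , v = next-H x 0<B h v
    vert : ∀ i k → i + k ≡ suc (suc d) → Valid A B (V i k) → Fixes I (V i k)
    vert (suc i) k p (x , y) = proj₂ (far-level l b i k (suc-injective p) x y)
    vert zero k refl (x , y) with far-level l b 0 (suc d) refl 0<A (<-trans (n<1+n _) y)
    ... | h , v = next-V I 0<A y h v

  -- The square at `(0 , 0)` is alone on its antidiagonal, so its near pair does not tell its far
  -- sides apart; all four sides are prescribed.
  StartFixed : Set
  StartFixed = (Fixes I (H 0 0) × Fixes I (V 0 0)) × (Fixes I (H 0 1) × Fixes I (V 1 0))

  level : 0 < A → 0 < B → StartFixed → ∀ d → 2 + d ≤ A + B → Level I d
  level 0<A 0<B ((h , v) , _) zero _ zero zero refl = (λ _ → h) , (λ _ → v)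
  level 0<A 0<B (_ , (h , v)) (suc zero) _ zero (suc zero) refl = (λ _ → h) , (λ (x , y) → next-V I 0<A y h v)
  level 0<A 0<B (_ , (h , v)) (suc zero) _ (suc zero) zero refl = (λ (x , y) → next-H x 0<B h v) , (λ _ → v)
  level 0<A 0<B s (suc (suc d)) b = next-level 0<A 0<B (level 0<A 0<B s (suc d) (≤-trans (n≤1+n _) b)) b

-- In the target `V A 0` has the partner `H A 0`, because `A < B`. In the source `H A 0` is invalid,
-- so the only candidate for its preimage is the other partner `H (A - 1) 1` of `V A 0`. That facet
-- is on the same antidiagonal and hence fixed, a contradiction.
fixed⇒≮ : ∀ {A B} (I : Iso A B B A) → 0 < A → StartFixed I → ¬ A < B
fixed⇒≮ {suc a} {B} I 0<A s A<B = clash (pair-V (subst (λ x → Pair (suc a) B x (from (H (suc a) 0)))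
    (from-fixed I (≤-refl , 0<B) (proj₂ (l (suc a) 0 (+-identityʳ _)) (≤-refl , 0<B))) (from-pair (nearVH A<B 0<A))))
  where
  open Iso I
  0<B = <-trans 0<A A<B
  l : Level I (suc a)
  l = level I 0<A 0<B s (suc a) (subst (_≤ suc a + B) (+-comm (suc a) 2) (+-monoʳ-≤ (suc a) (≤-trans (s≤s 0<A) A<B)))
  clash : ¬ (from (H (suc a) 0) ≡ H (suc a) 0 ⊎ ∃ λ i′ → suc a ≡ suc i′ × from (H (suc a) 0) ≡ H i′ 1)
  clash (inj₁ u) = 1+n≰n (proj₁ (subst (Valid (suc a) B) u (from-valid (A<B , z≤n))))
  clash (inj₂ (_ , refl , u)) with trans (sym (to-from (A<B , z≤n))) (trans (cong to u) (proj₁ (l a 1 (+-comm a 1)) (≤-refl , 0<B)))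
  ... | ()

fixed⇒≡ : ∀ {A B} (I : Iso A B B A) → 0 < A → 0 < B → StartFixed I → A ≡ B
fixed⇒≡ I 0<A 0<B s@((h , v) , (h′ , v′)) = ≤-antisym
  (≮⇒≥ (fixed⇒≮ (κ-conj I) 0<B ((κ-fixes I v , κ-fixes I h) , (κ-fixes I v′ , κ-fixes I h′))))
  (≮⇒≥ (fixed⇒≮ I 0<A s))

module _ {A B a′ b′ : ℕ} (I : Iso A B (suc a′) (suc b′)) (0<A : 0 < A) (0<B : 0 < B) where
  open Iso I

  private
    only-V : ∀ {y} → Pair (suc a′) (suc b′) (to (V 0 0)) y → y ≡ to (H 0 0)
    only-V {y} p with pair-V (subst (λ x → Pair A B x (from y)) (from-to {V 0 0} (z≤n , 0<B)) (from-pair p))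
    ... | inj₁ q = trans (sym (to-from (pair-valid p))) (cong to q)

    only-H : ∀ {y} → Pair (suc a′) (suc b′) (to (H 0 0)) y → y ≡ to (V 0 0)
    only-H {y} p with pair-H (subst (λ x → Pair A B x (from y)) (from-to {H 0 0} (0<A , z≤n)) (from-pair p))
    ... | inj₁ q = trans (sym (to-from (pair-valid p))) (cong to q)

  data Corner : Facet → Facet → Set where
    startHV : Corner (H 0 0) (V 0 0)
    startVH : Corner (V 0 0) (H 0 0)
    endHV   : Corner (H a′ (suc b′)) (V (suc a′) b′)
    endVH   : Corner (V (suc a′) b′) (H a′ (suc b′))

  -- `H 0 0` and `V 0 0` are each other's only partner, and so are their images. Only the first and
  -- the last antidiagonal consist of such an isolated pair; on any other, one member of a pair has
  -- a second partner.
  corner-image : Corner (to (H 0 0)) (to (V 0 0))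
  corner-image = go (to-pair (nearHV 0<A 0<B)) only-H only-V
    where
    last : ∀ {m n} → n < suc m → ¬ n < m → n ≡ m
    last p q = ≤-antisym (s≤s⁻¹ p) (≮⇒≥ q)

    go : ∀ {e f} → Pair (suc a′) (suc b′) e f → (∀ {y} → Pair (suc a′) (suc b′) e y → y ≡ f) →
         (∀ {y} → Pair (suc a′) (suc b′) f y → y ≡ e) → Corner e f
    go (nearHV {zero} {zero} p q) ue uf = startHV
    go (nearHV {suc i} p q) ue uf with uf (farVH (<⇒≤ p) q)
    ... | ()
    go (nearHV {zero} {suc k} p q) ue uf with ue (farHV p (<⇒≤ q))
    ... | ()
    go (nearVH {zero} {zero} p q) ue uf = startVH
    go (nearVH {suc i} p q) ue uf with ue (farVH (<⇒≤ p) q)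
    ... | ()
    go (nearVH {zero} {suc k} p q) ue uf with uf (farHV p (<⇒≤ q))
    ... | ()
    go (farHV {i} {k} p q) ue uf
      with last p (λ r → case uf (nearVH (s≤s r) q) of λ ()) | last q (λ r → case ue (nearHV p (s≤s r)) of λ ())
    ... | refl | refl = endHV
    go (farVH {i} {k} p q) ue uf
      with last p (λ r → case ue (nearVH (s≤s r) q) of λ ()) | last q (λ r → case uf (nearHV p (s≤s r)) of λ ())
    ... | refl | refl = endVH

  has-pair : ∀ {e} → Valid (suc a′) (suc b′) e → e ≡ bot ⊎ e ≡ top ⊎ ∃ (Pair (suc a′) (suc b′) e)
  has-pair {bot} _ = inj₁ refl
  has-pair {top} _ = inj₂ (inj₁ refl)
  has-pair {H i zero}    (p , q) = inj₂ (inj₂ (_ , nearHV p (s≤s z≤n)))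
  has-pair {H i (suc k)} (p , q) = inj₂ (inj₂ (_ , farHV p q))
  has-pair {V zero k}    (p , q) = inj₂ (inj₂ (_ , nearVH (s≤s z≤n) q))
  has-pair {V (suc i) k} (p , q) = inj₂ (inj₂ (_ , farVH p q))

  -- `bot` and `top` are the only facets without a partner, by `has-pair`.
  apex-image : ∀ {e} → Valid A B e → (∀ {f} → ¬ Pair A B e f) → to e ≡ bot ⊎ to e ≡ top
  apex-image {e} v n with has-pair (to-valid v)
  ... | inj₁ p = inj₁ p
  ... | inj₂ (inj₁ p) = inj₂ p
  ... | inj₂ (inj₂ (f , p)) = ⊥-elim (n (subst (λ x → Pair A B x (from f)) (from-to v) (from-pair p)))

-- Faces as sets of vertices

2ℚ : ℚ
2ℚ = 1ℚ ℚ.+ 1ℚ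

1≤2 : 1ℚ ℚ.≤ 2ℚ
1≤2 = from-yes (1ℚ ℚ.≤? 2ℚ)

2≰1 : ¬ 2ℚ ℚ.≤ 1ℚ
2≰1 = from-no (2ℚ ℚ.≤? 1ℚ)

idx≡ : ∀ {n} {p q : Idx n} → row p ≡ row q → col p ≡ col q → p ≡ q
idx≡ {p = (i , j) , l} {(i′ , j′) , l′} r c with toℕ-injective r | toℕ-injective c
... | refl | refl = cong ((i , j) ,_) (≤-irrelevant l l′)

at : ∀ {n} r c → c ≤ r → r < n → Idx n
at r c c≤r r<n = (fromℕ< r<n , fromℕ< (≤-<-trans c≤r r<n))
               , subst₂ _≤_ (sym (toℕ-fromℕ< _)) (sym (toℕ-fromℕ< _)) c≤r

row-at : ∀ {n} r c (p : c ≤ r) (q : r < n) → row (at r c p q) ≡ r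
row-at r c p q = toℕ-fromℕ< q

col-at : ∀ {n} r c (p : c ≤ r) (q : r < n) → col (at r c p q) ≡ c
col-at r c p q = toℕ-fromℕ< _

Tight : ℕ → ℕ → Filling → Facet → Set
Tight A B v e = tight A B v e ≡ true

module _ {A B : ℕ} where

  -- An equality along an edge of the triangle need not be a facet: near the prescribed entries it
  -- can be an intersection of several facets or hold everywhere. Such a list, found for each edge
  -- and then for each edge set, presents every face as an intersection of facets.
  record Described (P : Filling → Set) : Set where
    field
      facets : List Facet
      valid  : All (Valid A B) facets
      ⇒      : ∀ {v} → Monotone A B v → P v → All (Tight A B v) facets
      ⇐      : ∀ {v} → Monotone A B v → All (Tight A B v) facets → P v
  open Described

  described-⇔ : ∀ {P Q : Filling → Set} → (∀ {v} → Monotone A B v → Q v → P v) → (∀ {v} → Monotone A B v → P v → Q v) →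
                Described P → Described Q
  described-⇔ f g d = record { facets = facets d ; valid = valid d ; ⇒ = λ m q → ⇒ d m (f m q) ; ⇐ = λ m a → g m (⇐ d m a) }

  described-⊤ : ∀ {P : Filling → Set} → (∀ {v} → P v) → Described P
  described-⊤ p = record { facets = [] ; valid = [] ; ⇒ = λ _ _ → [] ; ⇐ = λ _ _ → p }

  described-tight : ∀ {e} → Valid A B e → Described (λ v → Tight A B v e)
  described-tight {e} v = record { facets = e ∷ [] ; valid = v ∷ [] ; ⇒ = λ _ t → t ∷ [] ; ⇐ = λ { _ (t ∷ []) → t } }

  described-× : ∀ {P Q : Filling → Set} → Described P → Described Q → Described (λ v → P v × Q v)
  described-× d d′ = record
    { facets = facets d ++ facets d′ ; valid = All.++⁺ (valid d) (valid d′)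
    ; ⇒ = λ { m (p , q) → All.++⁺ (⇒ d m p) (⇒ d′ m q) }
    ; ⇐ = λ m a → ⇐ d m (All.++⁻ˡ (facets d) a) , ⇐ d′ m (All.++⁻ʳ (facets d) a) }

  described-Π : ∀ {X : Set} {P : X → Filling → Set} → Dec X → (∀ x y → P x ≡ P y) → ((x : X) → Described (P x)) →
                Described (λ v → ∀ x → P x v)
  described-Π (yes x) irr d = described-⇔ (λ _ f → f x) (λ {v} _ p y → subst id (cong (λ Q → Q v) (irr x y)) p) (d x)
  described-Π (no ¬x) irr d = described-⊤ (λ x → ⊥-elim (¬x x))

  described-Fin : ∀ n {P : Fin n → Filling → Set} → (∀ i → Described (P i)) → Described (λ v → ∀ i → P i v)
  described-Fin zero    d = described-⊤ (λ ())
  described-Fin (suc n) d = described-⇔ (λ _ f → f zero , f ∘ suc) (λ { _ (p , f) zero → p ; _ (p , f) (suc i) → f i })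
                              (described-× (d zero) (described-Fin n (d ∘ suc)))

  -- If `v 0 k` has the lower value, so have all entries from it down to the least one `v 0 B`. The
  -- face is therefore cut out by `V 0 k`, ..., `V 0 (B - 1)` and `bot`.
  described-lo : ∀ d k → d + k ≡ B → Described (λ v → v 0 k ≡ false)
  described-lo zero k refl = described-⇔ (λ _ → cong not) (λ {v} _ p → trans (sym (not-involutive (v 0 B))) (cong not p)) (described-tight {bot} tt)
  described-lo (suc d) k refl = described-⇔ to from (described-× (described-tight {V 0 k} (z≤n , k<B)) (described-lo d (suc k) (+-suc d k)))
    where
    k<B : k < B
    k<B = s≤s (m≤n+m k d)
    to : ∀ {v} → Monotone A B v → v 0 k ≡ false → Tight A B v (V 0 k) × v 0 (suc k) ≡ false
    to {v} (_ , m) p with v 0 (suc k) | m 0 k z≤n k<B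
    ... | false | _ = ≡⇒eqb p , refl
    ... | true  | f = case trans (sym p) (f refl) of λ ()
    from : ∀ {v} → Monotone A B v → Tight A B v (V 0 k) × v 0 (suc k) ≡ false → v 0 k ≡ false
    from _ (t , p) = trans (eqb⇒≡ t) p

  described-hi : ∀ d i → d + i ≡ A → Described (λ v → v i 0 ≡ true)
  described-hi zero i refl = described-tight {top} tt
  described-hi (suc d) i refl = described-⇔ to from (described-× (described-tight {H i 0} (i<A , z≤n)) (described-hi d (suc i) (+-suc d i)))
    where
    i<A : i < A
    i<A = s≤s (m≤n+m i d)
    to : ∀ {v} → Monotone A B v → v i 0 ≡ true → Tight A B v (H i 0) × v (suc i) 0 ≡ true
    to (m , _) p = ≡⇒eqb (trans p (sym (m i 0 i<A z≤n p))) , m i 0 i<A z≤n p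
    from : ∀ {v} → Monotone A B v → Tight A B v (H i 0) × v (suc i) 0 ≡ true → v i 0 ≡ true
    from _ (t , p) = trans (eqb⇒≡ t) p

-- Fillings of the grid as vertices of the triangle, and cuts of its points

module Bridge (A B : ℕ) where

  n : ℕ
  n = suc B + suc A

  Mono : Filling → Set
  Mono = Monotone A B

  -- The diagonal freezes two triangles: rows up to `B` lie between diagonal entries equal to 1, and
  -- columns beyond `B` lie above a diagonal entry equal to 2. The free entries left form the grid.
  val : Filling → ℕ → ℕ → Bool
  val v r c = if r <ᵇ suc B then false else if B <ᵇ c then true else v (r ∸ suc B) (B ∸ c)

  data Region (r c : ℕ) : Set where
    lo  : r ≤ B → Region r c
    hi  : B < r → B < c → Region r c
    mid : ∀ i k → r ≡ suc B + i → c + k ≡ B → Region r c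

  region : ∀ r c → c ≤ r → Region r c
  region r c c≤r with r ≤? B | c ≤? B
  ... | yes p | _     = lo p
  ... | no p  | no q  = hi (≰⇒> p) (≰⇒> q)
  ... | no p  | yes q = mid (r ∸ suc B) (B ∸ c) (sym (m+[n∸m]≡n (≰⇒> p))) (m+[n∸m]≡n q)

  module _ (v : Filling) where

    val-lo : ∀ {r} c → r ≤ B → val v r c ≡ false
    val-lo {r} c p rewrite dec-true (r <? suc B) (s≤s p) = refl

    val-hi : ∀ {r c} → B < r → B < c → val v r c ≡ true
    val-hi {r} {c} p q rewrite dec-false (r <? suc B) (λ l → <⇒≱ p (s≤s⁻¹ l)) | dec-true (B <? c) q = refl

    val-mid : ∀ {r c i k} → r ≡ suc B + i → c + k ≡ B → val v r c ≡ v i k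
    val-mid {c = c} {i} {k} refl q
      rewrite dec-false (suc B + i <? suc B) (m+n≮m (suc B) i) | dec-false (B <? c) (≤⇒≯ (subst (c ≤_) q (m≤m+n c k)))
            | m+n∸m≡n (suc B) i | sym q | m+n∸m≡n c k = refl

  mid-i : ∀ {r i} → r ≡ suc B + i → r < n → i ≤ A
  mid-i {i = i} refl p = s≤s⁻¹ (+-cancelˡ-< (suc B) i (suc A) p)

  mid-k : ∀ {c k} → c + k ≡ B → k ≤ B
  mid-k {c} {k} p = subst (k ≤_) p (m≤n+m k c)

  described-row : ∀ {r c} → c ≤ r → suc r < n → Described {A} {B} (λ v → val v r c ≡ val v (suc r) c)
  described-row {r} {c} c≤r r<n with <-cmp r B | region r c c≤r
  ... | tri< r<B _ _ | _ = described-⊤ (λ {v} → trans (val-lo v c (<⇒≤ r<B)) (sym (val-lo v c r<B)))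
  ... | tri≈ _ refl _ | _ = described-⇔ (λ {v} _ p → trans (sym (v₁ v)) (trans (sym p) (val-lo v c ≤-refl)))
                                        (λ {v} _ p → trans (val-lo v c ≤-refl) (sym (trans (v₁ v) p)))
                                        (described-lo c (B ∸ c) (m+[n∸m]≡n c≤r))
    where v₁ : ∀ v → val v (suc B) c ≡ v 0 (B ∸ c)
          v₁ v = val-mid v (cong suc (sym (+-identityʳ B))) (m+[n∸m]≡n c≤r)
  ... | tri> _ _ B<r | lo p   = ⊥-elim (<⇒≱ B<r p)
  ... | tri> _ _ B<r | hi p q = described-⊤ (λ {v} → trans (val-hi v p q) (sym (val-hi v (m≤n⇒m≤1+n p) q)))
  ... | tri> _ _ B<r | mid i k refl q = described-⇔
          (λ {v} _ p → ≡⇒eqb (trans (sym (val-mid v refl q)) (trans p (val-mid v (cong suc (sym (+-suc B i))) q))))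
          (λ {v} _ t → trans (val-mid v refl q) (trans (eqb⇒≡ t) (sym (val-mid v (cong suc (sym (+-suc B i))) q))))
          (described-tight {e = H i k} (mid-i (cong suc (sym (+-suc B i))) r<n , mid-k q))

  described-col : ∀ {r c} → suc c ≤ r → r < n → Described {A} {B} (λ v → val v r c ≡ val v r (suc c))
  described-col {r} {c} c<r r<n with region r (suc c) c<r | region r c (<⇒≤ c<r)
  ... | lo p | _ = described-⊤ (λ {v} → trans (val-lo v c p) (sym (val-lo v (suc c) p)))
  ... | hi p q | lo r      = ⊥-elim (<⇒≱ p r)
  ... | hi p q | hi _ r    = described-⊤ (λ {v} → trans (val-hi v p r) (sym (val-hi v p q)))
  ... | hi p q | mid i zero s t = described-⇔
          (λ {v} _ e → trans (sym (val-mid v s t)) (trans e (val-hi v p q)))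
          (λ {v} _ e → trans (val-mid v s t) (trans e (sym (val-hi v p q))))
          (described-hi (A ∸ i) i (m∸n+n≡m (mid-i s r<n)))
  ... | hi p q | mid i (suc k) s t = ⊥-elim (<⇒≱ q (subst (suc c ≤_) t (subst (suc c ≤_) (sym (+-suc c k)) (s≤s (m≤m+n c k)))))
  ... | mid i k s t | _ = described-⇔
          (λ {v} _ e → ≡⇒eqb (trans (sym (val-mid v s t)) (trans (sym e) (val-mid v s t′))))
          (λ {v} _ e → trans (val-mid v s t′) (trans (sym (eqb⇒≡ e)) (sym (val-mid v s t))))
          (described-tight {e = V i k} (mid-i s r<n , subst (suc k ≤_) t′ (m≤n+m (suc k) c)))
    where t′ : c + suc k ≡ B
          t′ = trans (+-suc c k) t

  valᵢ : Filling → Idx n → Bool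
  valᵢ v p = val v (row p) (col p)

  In : Filling → EdgeSet n → Set
  In v S = ∀ p q → Adj p q → S p q ≡ true → valᵢ v p ≡ valᵢ v q

  adj? : ∀ (p q : Idx n) → Dec (Adj p q)
  adj? p q = ((row q ≟ suc (row p)) ×-dec (col q ≟ col p)) ⊎-dec ((row q ≟ row p) ×-dec (col q ≟ suc (col p)))

  row<n : ∀ (p : Idx n) → row p < n
  row<n ((i , _) , _) = toℕ<n i

  described-adj : ∀ p q → Adj p q → Described {A} {B} (λ v → valᵢ v p ≡ valᵢ v q)
  described-adj p q (inj₁ (r , c)) = subst₂ (λ r′ c′ → Described {A} {B} (λ v → valᵢ v p ≡ val v r′ c′)) (sym r) (sym c)
    (described-row (proj₂ p) (subst (_< n) r (row<n q)))
  described-adj p q (inj₂ (r , c)) = subst₂ (λ r′ c′ → Described {A} {B} (λ v → valᵢ v p ≡ val v r′ c′)) (sym r) (sym c)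
    (described-col (subst₂ _≤_ c r (proj₂ q)) (row<n p))

  described-idx : ∀ {P : Idx n → Filling → Set} → (∀ p → Described {A} {B} (P p)) → Described {A} {B} (λ v → ∀ p → P p v)
  described-idx {P} d = described-⇔ (λ _ f i j l → f ((i , j) , l)) (λ _ f p → f _ _ (proj₂ p))
    (described-Fin n λ i → described-Fin n λ j → described-Π (toℕ j ≤? toℕ i)
      (λ l l′ → cong (λ l → P ((i , j) , l)) (≤-irrelevant l l′)) λ l → d ((i , j) , l))

  opaque
    described-In : ∀ S → Described {A} {B} (λ v → In v S)
    described-In S = described-idx λ p → described-idx λ q → described-Π (adj? p q) (λ _ _ → refl) λ a →
      described-Π (S p q Data.Bool.≟ true) (λ _ _ → refl) λ _ → described-adj p q a

  step : ∀ {v} → Mono v → ∀ p q → Adj p q → valᵢ v p ≡ true → valᵢ v q ≡ true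
  step {v} m p q a t with region (row p) (col p) (proj₂ p) | region (row q) (col q) (proj₂ q)
  ... | lo r      | _ = case trans (sym t) (val-lo v (col p) r) of λ ()
  ... | _         | hi r s = val-hi v r s
  step {v} m p q (inj₁ (e , e′)) t | hi r s | lo x rewrite e = ⊥-elim (<⇒≱ r (≤-trans (n≤1+n _) x))
  step {v} m p q (inj₂ (e , e′)) t | hi r s | lo x rewrite e = ⊥-elim (<⇒≱ r x)
  step {v} m p q (inj₁ (e , e′)) t | hi r s | mid i k x y = ⊥-elim (<⇒≱ s (subst₂ _≤_ e′ y (m≤m+n (col q) k)))
  step {v} m p q (inj₂ (e , e′)) t | hi r s | mid i k x y = ⊥-elim (<⇒≱ s (≤-trans (n≤1+n _) (subst₂ _≤_ e′ y (m≤m+n (col q) k))))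
  step {v} m p q (inj₁ (e , e′)) t | mid i k r s | lo x = ⊥-elim (1+n≰n (≤-trans (s≤s (≤-trans (m≤m+n B i) (n≤1+n _))) (subst (_≤ B) (trans e (cong suc r)) x)))
  step {v} m p q (inj₂ (e , e′)) t | mid i k r s | lo x = ⊥-elim (1+n≰n (≤-trans (s≤s (m≤m+n B i)) (subst (_≤ B) (trans e r) x)))
  step {v} (m , _) p q (inj₁ (e , e′)) t | mid i k r s | mid i′ k′ r′ s′
    with +-cancelˡ-≡ (suc B) i′ (suc i) (trans (sym r′) (trans e (trans (cong suc r) (cong suc (sym (+-suc B i))))))
       | +-cancelˡ-≡ (col p) k′ k (trans (cong (_+ k′) (sym e′)) (trans s′ (sym s)))
  ... | refl | refl = trans (val-mid v r′ s′) (m i k (mid-i r′ (row<n q)) (mid-k s) (trans (sym (val-mid v r s)) t))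
  step {v} (_ , m) p q (inj₂ (e , e′)) t | mid i k r s | mid i′ k′ r′ s′
    with +-cancelˡ-≡ (suc B) i′ i (trans (sym r′) (trans e r))
       | +-cancelˡ-≡ (col p) k (suc k′) (trans (trans s (sym s′)) (trans (cong (_+ k′) e′) (sym (+-suc (col p) k′))))
  ... | refl | refl = trans (val-mid v r′ s′) (m i k′ (mid-i r′ (row<n q)) (mid-k s) (trans (sym (val-mid v r s)) t))

  toℚ : Bool → ℚ
  toℚ b = if b then 2ℚ else 1ℚ

  toℚ-injective : ∀ {x y} → toℚ x ≡ toℚ y → x ≡ y
  toℚ-injective {false} {false} _ = refl
  toℚ-injective {false} {true}  p = ⊥-elim (2≰1 (ℚ.≤-reflexive (sym p)))
  toℚ-injective {true}  {false} p = ⊥-elim (2≰1 (ℚ.≤-reflexive p))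
  toℚ-injective {true}  {true}  _ = refl

  toℚ-mono : ∀ {x y} → (x ≡ true → y ≡ true) → toℚ x ℚ.≤ toℚ y
  toℚ-mono {true}  {y}     f rewrite f refl = ℚ.≤-refl
  toℚ-mono {false} {false} f = ℚ.≤-refl
  toℚ-mono {false} {true}  f = 1≤2

  vertex : Filling → Point n
  vertex v p = toℚ (valᵢ v p)

  vertex-InGT : ∀ {v} → Mono v → InGT (suc B) (suc A) (vertex v)
  vertex-InGT {v} m = diagonal , λ p q a → toℚ-mono (step m p q a)
    where
    diagonal : ∀ i → vertex v (diag i) ≡ lam (suc B) (suc A) i
    diagonal i with toℕ i <ᵇ suc B in eq
    ... | true  = refl
    ... | false rewrite dec-true (B <? toℕ i) (≰⇒> λ l → case trans (sym eq) (dec-true (toℕ i <? suc B) (s≤s l)) of λ ()) = refl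

  _⊑_ : EdgeSet n → EdgeSet n → Set
  S ⊑ T = ∀ v → Mono v → In v S → In v T

  Sub⇒⊑ : ∀ {S T} → Sub (suc B) (suc A) S T → S ⊑ T
  Sub⇒⊑ s v m i p q a t = toℚ-injective (proj₂ (s (vertex v) (vertex-InGT m , λ p q a t → cong toℚ (i p q a t))) p q a t)

  module Threshold (x : Point n) (x∈ : InGT (suc B) (suc A) x) (t : ℚ) (1≤t : 1ℚ ℚ.≤ t) (2≰t : ¬ 2ℚ ℚ.≤ t) where

    above : Idx n → Bool
    above p = not (does (x p ℚ.≤? t))

    above-mono : ∀ {p q} → x p ℚ.≤ x q → above p ≡ true → above q ≡ true
    above-mono {p} {q} l e with x q ℚ.≤? t
    ... | no b  = cong not (dec-false (x q ℚ.≤? t) b)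
    ... | yes b = case trans (sym e) (cong not (dec-true (x p ℚ.≤? t) (ℚ.≤-trans l b))) of λ ()

    lam-diag : ∀ r (r<n : r < n) → x (at r r ≤-refl r<n) ≡ toℚ (B <ᵇ r)
    lam-diag r r<n = trans (cong x (idx≡ {q = diag (fromℕ< r<n)} refl (trans (col-at r r ≤-refl r<n) (sym (row-at r r ≤-refl r<n)))))
      (trans (proj₁ x∈ (fromℕ< r<n)) (trans (cong (λ s → if s <ᵇ suc B then 1ℚ else 2ℚ) (toℕ-fromℕ< r<n)) (swap-if (r ≤? B))))
      where
      swap-if : Dec (r ≤ B) → (if r <ᵇ suc B then 1ℚ else 2ℚ) ≡ toℚ (B <ᵇ r)
      swap-if (yes p) rewrite dec-true (r <? suc B) (s≤s p) | dec-false (B <? r) (≤⇒≯ p) = refl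
      swap-if (no p)  rewrite dec-false (r <? suc B) (p ∘ s≤s⁻¹) | dec-true (B <? r) (≰⇒> p) = refl

    lower : ∀ d r c (c≤r : c ≤ r) (r<n : r < n) (c<n : c < n) → d + c ≡ r → x (at c c ≤-refl c<n) ℚ.≤ x (at r c c≤r r<n)
    lower zero r .r c≤r r<n c<n refl = ℚ.≤-reflexive (cong x (idx≡ (trans (row-at r r ≤-refl c<n) (sym (row-at r r c≤r r<n))) (trans (col-at r r ≤-refl c<n) (sym (col-at r r c≤r r<n)))))
    lower (suc d) .(suc (d + c)) c c≤r r<n c<n refl = ℚ.≤-trans (lower d (d + c) c (m≤n+m c d) r′<n c<n refl)
      (proj₂ x∈ _ _ (inj₁ ( trans (row-at _ c c≤r r<n) (cong suc (sym (row-at _ c (m≤n+m c d) r′<n)))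
                          , trans (col-at _ c c≤r r<n) (sym (col-at _ c (m≤n+m c d) r′<n)))))
      where r′<n = <-trans (n<1+n _) r<n

    upper : ∀ d r c (c≤r : c ≤ r) (r<n : r < n) → d + c ≡ r → x (at r c c≤r r<n) ℚ.≤ x (at r r ≤-refl r<n)
    upper zero r .r c≤r r<n refl = ℚ.≤-reflexive (cong x (idx≡ refl (trans (col-at r r c≤r r<n) (sym (col-at r r ≤-refl r<n)))))
    upper (suc d) r c c≤r r<n e = ℚ.≤-trans
      (proj₂ x∈ _ (at r (suc c) c<r r<n) (inj₂ (refl , trans (col-at r (suc c) c<r r<n) (cong suc (sym (col-at r c c≤r r<n))))))
      (upper d r (suc c) c<r r<n (trans (+-suc d c) e))
      where c<r : suc c ≤ r
            c<r = subst (suc c ≤_) e (s≤s (m≤n+m c d))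

    at-self : ∀ p → p ≡ at (row p) (col p) (proj₂ p) (row<n p)
    at-self p = idx≡ (sym (row-at _ (col p) (proj₂ p) (row<n p))) (sym (col-at _ (col p) (proj₂ p) (row<n p)))

    x-lower : ∀ p → toℚ (B <ᵇ col p) ℚ.≤ x p
    x-lower p = subst₂ ℚ._≤_ (lam-diag (col p) (≤-<-trans (proj₂ p) (row<n p))) (cong x (sym (at-self p)))
      (lower (row p ∸ col p) (row p) (col p) (proj₂ p) (row<n p) (≤-<-trans (proj₂ p) (row<n p)) (m∸n+n≡m (proj₂ p)))

    x-upper : ∀ p → x p ℚ.≤ toℚ (B <ᵇ row p)
    x-upper p = subst₂ ℚ._≤_ (cong x (sym (at-self p))) (lam-diag (row p) (row<n p))
      (upper (row p ∸ col p) (row p) (col p) (proj₂ p) (row<n p) (m∸n+n≡m (proj₂ p)))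

    mid-≤ : ∀ i k → B ∸ k ≤ suc B + i
    mid-≤ i k = ≤-trans (m∸n≤m B k) (≤-trans (n≤1+n B) (m≤m+n (suc B) i))

    cut : Filling
    cut i k with suc B + i <? n
    ... | yes p = above (at (suc B + i) (B ∸ k) (mid-≤ i k) p)
    -- A default for rows outside the triangle; `cut-at` reads only actual entries.
    ... | no _  = true

    cut-at : ∀ p {i k} → row p ≡ suc B + i → col p + k ≡ B → cut i k ≡ above p
    cut-at p {i} {k} r c with suc B + i <? n
    ... | no q  = ⊥-elim (q (subst (_< n) r (row<n p)))
    ... | yes q = cong above (idx≡ (trans (row-at _ (B ∸ k) (mid-≤ i k) q) (sym r))
                    (trans (col-at (suc B + i) (B ∸ k) (mid-≤ i k) q) (trans (cong (_∸ k) (sym c)) (m+n∸n≡m (col p) k))))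

    val-cut : ∀ p → valᵢ cut p ≡ above p
    val-cut p with region (row p) (col p) (proj₂ p)
    ... | lo r = trans (val-lo cut (col p) r) (sym (cong not (dec-true (x p ℚ.≤? t)
                   (ℚ.≤-trans (subst (λ b → x p ℚ.≤ toℚ b) (dec-false (B <? row p) (≤⇒≯ r)) (x-upper p)) 1≤t))))
    ... | hi r c = trans (val-hi cut r c) (sym (cong not (dec-false (x p ℚ.≤? t)
                   (λ l → 2≰t (ℚ.≤-trans (subst (λ b → toℚ b ℚ.≤ x p) (dec-true (B <? col p) c) (x-lower p)) l)))))
    ... | mid i k r c = trans (val-mid cut r c) (cut-at p r c)

    point-of : ∀ i k → i ≤ A → k ≤ B → Σ (Idx n) λ p → row p ≡ suc B + i × col p + k ≡ B
    point-of i k i≤A k≤B = at (suc B + i) (B ∸ k) l q , row-at (suc B + i) (B ∸ k) l q , trans (cong (_+ k) (col-at (suc B + i) (B ∸ k) l q)) (m∸n+n≡m k≤B)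
      where l = mid-≤ i k
            q : suc B + i < n
            q = +-monoʳ-< (suc B) (s≤s i≤A)

    cut-mono : Mono cut
    cut-mono = (λ i k p q → link (point-of i k (<⇒≤ p) q) (point-of (suc i) k p q) (λ (r , c) (r′ , c′) →
                   inj₁ (trans r′ (trans (cong suc (+-suc B i)) (cong suc (sym r))) , +-cancelʳ-≡ k _ _ (trans c′ (sym c)))))
             , (λ i k p q → link (point-of i (suc k) p q) (point-of i k p (<⇒≤ q)) (λ {s} {s′} (r , c) (r′ , c′) →
                   inj₂ (trans r′ (sym r) , +-cancelʳ-≡ k _ _ (trans c′ (trans (sym c) (+-suc (col s) k))))))
      where
      link : ∀ {i k i′ k′} → (p : Σ (Idx n) λ p → row p ≡ suc B + i × col p + k ≡ B) → (q : Σ (Idx n) λ p → row p ≡ suc B + i′ × col p + k′ ≡ B) →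
             (∀ {p q} → row p ≡ suc B + i × col p + k ≡ B → row q ≡ suc B + i′ × col q + k′ ≡ B → Adj p q) → cut i k ≡ true → cut i′ k′ ≡ true
      link (p , r , c) (q , r′ , c′) a e = trans (cut-at q r′ c′) (above-mono {p} {q} (proj₂ x∈ p q (a {p} {q} (r , c) (r′ , c′))) (trans (sym (cut-at p r c)) e))

  -- If x p < x q, cutting x at the level x p gives a vertex of the face of x at which p and q differ.
  ⊑⇒Sub : ∀ {S T} → S ⊑ T → Sub (suc B) (suc A) S T
  ⊑⇒Sub {S} {T} s x (x∈ , x∈S) = x∈ , tight-T
    where
    tight-T : ∀ p q → Adj p q → T p q ≡ true → x p ≡ x q
    tight-T p q a t with x q ℚ.≤? x p
    ... | yes l = ℚ.≤-antisym (proj₂ x∈ p q a) l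
    ... | no l  = ⊥-elim (case trans (sym above-q) (trans (sym (C.val-cut q)) (trans (sym tight-cut) (trans (C.val-cut p) above-p))) of λ ())
      where
      below-2 : ∀ b → toℚ b ℚ.≤ 2ℚ
      below-2 true  = ℚ.≤-refl
      below-2 false = 1≤2
      above-1 : ∀ b → 1ℚ ℚ.≤ toℚ b
      above-1 true  = 1≤2
      above-1 false = ℚ.≤-refl
      -- The admissible level 1 supplies the bounds `1 ≤ x p` and `x q ≤ 2`, which do not depend on
      -- the level. With `x p < x q` they make `x p` itself an admissible level.
      module C₀ = Threshold x x∈ 1ℚ ℚ.≤-refl 2≰1
      module C = Threshold x x∈ (x p) (ℚ.≤-trans (above-1 _) (C₀.x-lower p)) (λ l′ → l (ℚ.≤-trans (C₀.x-upper q) (ℚ.≤-trans (below-2 _) l′)))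
      above-p : C.above p ≡ false
      above-p = cong not (dec-true (x p ℚ.≤? x p) ℚ.≤-refl)
      above-q : C.above q ≡ true
      above-q = cong not (dec-false (x q ℚ.≤? x p) l)
      tight-cut : valᵢ C.cut p ≡ valᵢ C.cut q
      tight-cut = s C.cut C.cut-mono (λ p′ q′ a′ t′ → trans (C.val-cut p′) (trans (cong (λ y → not (does (y ℚ.≤? x p))) (x∈S p′ q′ a′ t′)) (sym (C.val-cut q′)))) p q a t

-- Automorphisms as permutations of facets

_≟ᶠ_ : (e f : Facet) → Dec (e ≡ f)
bot   ≟ᶠ bot   = yes refl
bot   ≟ᶠ top   = no λ ()
bot   ≟ᶠ H _ _ = no λ ()
bot   ≟ᶠ V _ _ = no λ ()
top   ≟ᶠ bot   = no λ ()
top   ≟ᶠ top   = yes refl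
top   ≟ᶠ H _ _ = no λ ()
top   ≟ᶠ V _ _ = no λ ()
H _ _ ≟ᶠ bot   = no λ ()
H _ _ ≟ᶠ top   = no λ ()
H i k ≟ᶠ H j l = map′ (cong λ (x , y) → H x y) (λ { refl → refl }) (≡-dec _≟_ _≟_ (i , k) (j , l))
H _ _ ≟ᶠ V _ _ = no λ ()
V _ _ ≟ᶠ bot   = no λ ()
V _ _ ≟ᶠ top   = no λ ()
V _ _ ≟ᶠ H _ _ = no λ ()
V i k ≟ᶠ V j l = map′ (cong λ (x , y) → V x y) (λ { refl → refl }) (≡-dec _≟_ _≟_ (i , k) (j , l))

module _ {A B : ℕ} where

  opp-distinct : ∀ {e f g} → Opp A B e f g → g ≢ e × g ≢ f
  opp-distinct (nearHV _ _ (inj₁ refl)) = (λ ()) , (λ ())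
  opp-distinct (nearHV _ _ (inj₂ refl)) = (λ ()) , (λ ())
  opp-distinct (nearVH _ _ (inj₁ refl)) = (λ ()) , (λ ())
  opp-distinct (nearVH _ _ (inj₂ refl)) = (λ ()) , (λ ())
  opp-distinct (farHV _ _ (inj₁ refl))  = (λ ()) , (λ ())
  opp-distinct (farHV _ _ (inj₂ refl))  = (λ ()) , (λ ())
  opp-distinct (farVH _ _ (inj₁ refl))  = (λ ()) , (λ ())
  opp-distinct (farVH _ _ (inj₂ refl))  = (λ ()) , (λ ())

  opp-valid : ∀ {e f g} → Opp A B e f g → Valid A B g
  opp-valid (nearHV p q (inj₁ refl)) = p , q
  opp-valid (nearHV p q (inj₂ refl)) = p , q
  opp-valid (nearVH p q (inj₁ refl)) = p , q
  opp-valid (nearVH p q (inj₂ refl)) = p , q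
  opp-valid (farHV p q (inj₁ refl))  = p , <⇒≤ q
  opp-valid (farHV p q (inj₂ refl))  = <⇒≤ p , q
  opp-valid (farVH p q (inj₁ refl))  = p , <⇒≤ q
  opp-valid (farVH p q (inj₂ refl))  = <⇒≤ p , q

  ¬opp-diagonal : ∀ {e g} → ¬ Opp A B e e g
  ¬opp-diagonal ()

module Faces (A B : ℕ) where

  open Bridge A B public
  open Described

  Ok : Facet → Set
  Ok = Valid A B

  -- Row and column of both ends of one edge of the triangle representing the facet. For `bot` the
  -- edge joins a frozen one in row `B` to `v 0 B`; for `top` it joins `v A 0` to a frozen two in
  -- column `suc B`.
  ends : Facet → (ℕ × ℕ) × (ℕ × ℕ)
  ends bot     = (B , 0) , (suc B , 0)
  ends top     = (suc B + A , B) , (suc B + A , suc B)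
  ends (H i k) = (suc B + i , B ∸ k) , (suc B + suc i , B ∸ k)
  ends (V i k) = (suc B + i , B ∸ suc k) , (suc B + i , B ∸ k)

  coords : Idx n → ℕ × ℕ
  coords p = row p , col p

  opaque
    ⟦_⟧ : List Facet → EdgeSet n
    ⟦ es ⟧ p q = does (any? (λ e → ≡-dec (≡-dec _≟_ _≟_) (≡-dec _≟_ _≟_) (ends e) (coords p , coords q)) es)

    mark : ∀ {es p q} → Any (λ e → ends e ≡ (coords p , coords q)) es → ⟦ es ⟧ p q ≡ true
    mark e∈ = dec-true (any? _ _) e∈

    unmark : ∀ {es p q} → ⟦ es ⟧ p q ≡ true → Any (λ e → ends e ≡ (coords p , coords q)) es
    unmark {es} {p} {q} t with any? (λ e → ≡-dec (≡-dec _≟_ _≟_) (≡-dec _≟_ _≟_) (ends e) (coords p , coords q)) es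
    ... | yes e∈ = e∈

  val₂ : Filling → ℕ × ℕ → Bool
  val₂ v (r , c) = val v r c

  EqualEnds : Filling → Facet → Set
  EqualEnds v e = val₂ v (proj₁ (ends e)) ≡ val₂ v (proj₂ (ends e))

  module _ (v : Filling) where

    private
      val-H : ∀ {i k} → k ≤ B → val v (suc B + i) (B ∸ k) ≡ v i k
      val-H q = val-mid v refl (m∸n+n≡m q)

    tight⇒ends : ∀ e → Ok e → Tight A B v e → EqualEnds v e
    tight⇒ends bot _ t = trans (val-lo v 0 ≤-refl) (sym (trans (val-mid v (cong suc (sym (+-identityʳ B))) refl) (not-true t)))
    tight⇒ends top _ t = trans (val-mid v refl (+-identityʳ B)) (trans t (sym (val-hi v (s≤s (m≤m+n B A)) ≤-refl)))
    tight⇒ends (H i k) (p , q) t = trans (val-H q) (trans (eqb⇒≡ t) (sym (val-H q)))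
    tight⇒ends (V i k) (p , q) t = trans (val-H q) (trans (sym (eqb⇒≡ t)) (sym (val-H (<⇒≤ q))))

    ends⇒tight : ∀ e → Ok e → EqualEnds v e → Tight A B v e
    ends⇒tight bot _ t = cong Data.Bool.not (trans (sym (val-mid v (cong suc (sym (+-identityʳ B))) refl)) (trans (sym t) (val-lo v 0 ≤-refl)))
    ends⇒tight top _ t = trans (sym (val-mid v refl (+-identityʳ B))) (trans t (val-hi v (s≤s (m≤m+n B A)) ≤-refl))
    ends⇒tight (H i k) (p , q) t = ≡⇒eqb (trans (sym (val-H q)) (trans t (val-H q)))
    ends⇒tight (V i k) (p , q) t = ≡⇒eqb (trans (sym (val-H (<⇒≤ q))) (trans (sym t) (val-H q)))

  Edge : Facet → Set
  Edge e = Σ (Idx n) λ p → Σ (Idx n) λ q → Adj p q × ends e ≡ (coords p , coords q)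

  edge : ∀ e → Ok e → Edge e
  edge e v = build (proj₁ (ends e)) (proj₂ (ends e)) refl (inside e v)
    where
    Inside : ℕ × ℕ → ℕ × ℕ → Set
    Inside (r , c) (r′ , c′) = c ≤ r × c′ ≤ r′ × r < n × r′ < n × ((r′ ≡ suc r × c′ ≡ c) ⊎ (r′ ≡ r × c′ ≡ suc c))

    row-mid : ∀ {i} → i ≤ A → suc B + i < n
    row-mid p = +-monoʳ-< (suc B) (s≤s p)

    inside : ∀ e → Ok e → Inside (proj₁ (ends e)) (proj₂ (ends e))
    inside bot _ = z≤n , z≤n , s≤s (m≤m+n B (suc A)) , s≤s (m<m+n B (s≤s z≤n)) , inj₁ (refl , refl)
    inside top _ = ≤-trans (n≤1+n B) (m≤m+n (suc B) A) , m≤m+n (suc B) A , row-mid ≤-refl , row-mid ≤-refl , inj₂ (refl , refl)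
    inside (H i k) (p , q) = l , ≤-trans l (+-monoʳ-≤ (suc B) (n≤1+n i)) , row-mid (<⇒≤ p) , row-mid p , inj₁ (cong suc (+-suc B i) , refl)
      where l = ≤-trans (m∸n≤m B k) (≤-trans (n≤1+n B) (m≤m+n (suc B) i))
    inside (V i k) (p , q) = l (suc k) , l k , row-mid p , row-mid p , inj₂ (refl , +-∸-assoc 1 q)
      where l : ∀ k → B ∸ k ≤ suc B + i
            l k = ≤-trans (m∸n≤m B k) (≤-trans (n≤1+n B) (m≤m+n (suc B) i))

    build : ∀ x y → ends e ≡ (x , y) → Inside x y → Edge e
    build (r , c) (r′ , c′) s (l , l′ , m , m′ , a) = at r c l m , at r′ c′ l′ m′ , adj a , trans s
      (cong₂ _,_ (cong₂ _,_ (sym (row-at r c l m)) (sym (col-at r c l m))) (cong₂ _,_ (sym (row-at r′ c′ l′ m′)) (sym (col-at r′ c′ l′ m′))))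
      where
      adj : (r′ ≡ suc r × c′ ≡ c) ⊎ (r′ ≡ r × c′ ≡ suc c) → Adj (at r c l m) (at r′ c′ l′ m′)
      adj (inj₁ (x , y)) = inj₁ ( trans (row-at r′ c′ l′ m′) (trans x (cong suc (sym (row-at r c l m))))
                                , trans (col-at r′ c′ l′ m′) (trans y (sym (col-at r c l m))))
      adj (inj₂ (x , y)) = inj₂ ( trans (row-at r′ c′ l′ m′) (trans x (sym (row-at r c l m)))
                                , trans (col-at r′ c′ l′ m′) (trans y (cong suc (sym (col-at r c l m)))))

  ends-val : ∀ v e {p q} → ends e ≡ (coords p , coords q) → EqualEnds v e ≡ (valᵢ v p ≡ valᵢ v q)
  ends-val v e s = cong (λ (x , y) → val₂ v x ≡ val₂ v y) s

  In⇒tight : ∀ {v es} → All Ok es → In v ⟦ es ⟧ → All (Tight A B v) es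
  In⇒tight {v} {es} oks i = All.tabulate λ {e} e∈ → tight-at e e∈ (All.lookup oks e∈)
    where
    tight-at : ∀ e → _ → Ok e → Tight A B v e
    tight-at e e∈ ok with edge e ok
    ... | p , q , a , s = ends⇒tight v e ok (subst id (sym (ends-val v e {p} {q} s))
                            (i p q a (mark (Any.map (λ { refl → s }) e∈))))

  tight⇒In : ∀ {v es} → All Ok es → All (Tight A B v) es → In v ⟦ es ⟧
  tight⇒In {v} {es} oks ts p q _ t = go oks ts (unmark {es} t)
    where
    go : ∀ {es} → All Ok es → All (Tight A B v) es → Any (λ e → ends e ≡ (coords p , coords q)) es → valᵢ v p ≡ valᵢ v q
    go {e ∷ _} (o ∷ _) (t ∷ _) (here s)   = subst id (ends-val v e {p} {q} s) (tight⇒ends v e o t)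
    go         (_ ∷ o) (_ ∷ t) (there e∈) = go o t e∈

  ⟪_⟫ : Facet → EdgeSet n
  ⟪ e ⟫ = ⟦ e ∷ [] ⟧

  In⇒tight₁ : ∀ {v e} → Ok e → In v ⟪ e ⟫ → Tight A B v e
  In⇒tight₁ ok i = All.head (In⇒tight (ok ∷ []) i)

  tight⇒In₁ : ∀ {v e} → Ok e → Tight A B v e → In v ⟪ e ⟫
  tight⇒In₁ ok t = tight⇒In (ok ∷ []) (t ∷ [])

  ⊑-trans : ∀ {S T U} → S ⊑ T → T ⊑ U → S ⊑ U
  ⊑-trans p q v m i = q v m (p v m i)

  _≈_ : EdgeSet n → EdgeSet n → Set
  S ≈ T = S ⊑ T × T ⊑ S

  ≈-refl : ∀ {S} → S ≈ S
  ≈-refl = (λ v m i → i) , (λ v m i → i)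

  ≈-sym : ∀ {S T} → S ≈ T → T ≈ S
  ≈-sym (p , q) = q , p

  ≈-trans : ∀ {S T U} → S ≈ T → T ≈ U → S ≈ U
  ≈-trans {S} {T} {U} (p , q) (p′ , q′) = ⊑-trans {S} {T} {U} p p′ , ⊑-trans {U} {T} {S} q′ q

  -- A containment of facets is a `Meet` whose first two facets coincide, and `Opp` never pairs a
  -- facet with itself.
  antichain : ∀ {e f} → Ok e → Ok f → ⟪ e ⟫ ⊑ ⟪ f ⟫ → e ≡ f
  antichain {e} {f} oe of s = decidable-stable (e ≟ᶠ f) λ e≢f → ¬opp-diagonal (classify A B oe oe of (e≢f ∘ sym) (e≢f ∘ sym)
    (λ v m t _ → In⇒tight₁ of (s v m (tight⇒In₁ oe t))))

  proper : ∀ {e} → Ok e → ¬ (∀ T → T ⊑ ⟪ e ⟫)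
  proper {e} oe s = go (e ≟ᶠ bot)
    where
    go : Dec (e ≡ bot) → ⊥
    go (yes refl) = case antichain {top} {bot} tt tt (s ⟪ top ⟫) of λ ()
    go (no ≢bot)  = ≢bot (sym (antichain {bot} {e} tt oe (s ⟪ bot ⟫)))

  facetsOf : EdgeSet n → List Facet
  facetsOf S = facets (described-In S)

  headOr : List Facet → Facet
  headOr []      = bot
  headOr (e ∷ _) = e

  coatom : ∀ S → (∀ T → T ⊑ S) ⊎ (Ok (headOr (facetsOf S)) × S ⊑ ⟪ headOr (facetsOf S) ⟫)
  coatom S with facetsOf S | valid (described-In S) | ⇒ (described-In S) | ⇐ (described-In S)
  ... | []    | _      | _ | back = inj₁ λ T v m _ → back m []
  ... | e ∷ _ | ok ∷ _ | f | _    = inj₂ (ok , λ v m i → tight⇒In₁ ok (All.head (f m i)))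

  meet-of-facets : ∀ {S T} → (∀ e → Ok e → T ⊑ ⟪ e ⟫ → S ⊑ ⟪ e ⟫) → S ⊑ T
  meet-of-facets {S} {T} h v m i = ⇐ d m (All.tabulate λ {e} e∈ → In⇒tight₁ (ok e∈) (h e (ok e∈)
      (λ w m′ i′ → tight⇒In₁ (ok e∈) (All.lookup (⇒ d m′ i′) e∈)) v m i))
    where d = described-In T
          ok : ∀ {e} → _ → Ok e
          ok = All.lookup (valid d)

  Aut′ : Set
  Aut′ = Aut (suc B) (suc A)

  module _ (α : Aut′) where

    mono : ∀ {S T} → S ⊑ T → fun α S ⊑ fun α T
    mono s = Sub⇒⊑ (proj₁ (monoRefl α _ _) (⊑⇒Sub s))

    reflect : ∀ {S T} → fun α S ⊑ fun α T → S ⊑ T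
    reflect s = Sub⇒⊑ (proj₂ (monoRefl α _ _) (⊑⇒Sub s))

    inv : EdgeSet n → EdgeSet n
    inv T = proj₁ (surj α T)

    fun-inv : ∀ T → fun α (inv T) ≈ T
    fun-inv T = Sub⇒⊑ (proj₁ (proj₂ (surj α T))) , Sub⇒⊑ (proj₂ (proj₂ (surj α T)))

    fun-resp : ∀ {S T} → S ≈ T → fun α S ≈ fun α T
    fun-resp (p , q) = mono p , mono q

  inverse : Aut′ → Aut′
  inverse α = record
    { fun = inv α
    ; monoRefl = λ S T → (λ s → ⊑⇒Sub (reflect α (⊑-trans {fun α (inv α S)} {S} {fun α (inv α T)} (proj₁ (fun-inv α S))
                                                   (⊑-trans {S} {T} {fun α (inv α T)} (Sub⇒⊑ s) (proj₂ (fun-inv α T))))))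
                       , (λ s → ⊑⇒Sub (⊑-trans {S} {fun α (inv α S)} {T} (proj₂ (fun-inv α S))
                                        (⊑-trans {fun α (inv α S)} {fun α (inv α T)} {T} (mono α (Sub⇒⊑ s)) (proj₁ (fun-inv α T)))))
    ; surj = λ S → fun α S , ⊑⇒Sub (reflect α (proj₁ (fun-inv α (fun α S)))) , ⊑⇒Sub (reflect α (proj₂ (fun-inv α (fun α S)))) }

  Acts : Aut′ → (Facet → Facet) → Set
  Acts α σ = ∀ {e} → Ok e → Ok (σ e) × fun α ⟪ e ⟫ ≈ ⟪ σ e ⟫

  imageFacet : Aut′ → Facet → Facet
  imageFacet α e = headOr (facetsOf (fun α ⟪ e ⟫))

  -- The image of `e` is proper, so it lies in some facet `e′`. The preimage of `e′` is proper as
  -- well, lies in some facet `e″` and contains `e`; then `e ≡ e″` by `antichain`, and the image of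
  -- `e` is all of `e′`.
  imageFacet-acts : ∀ α → Acts α (imageFacet α)
  imageFacet-acts α {e} oe with coatom (fun α ⟪ e ⟫)
  ... | inj₁ full = ⊥-elim (proper oe (λ T → reflect α (full (fun α T))))
  ... | inj₂ (ok , s) = ok , s , back (coatom (inv α ⟪ e′ ⟫))
    where
    e′ e″ : Facet
    e′ = imageFacet α e
    e″ = headOr (facetsOf (inv α ⟪ e′ ⟫))
    e⊑ : ⟪ e ⟫ ⊑ inv α ⟪ e′ ⟫
    e⊑ = reflect α (⊑-trans {fun α ⟪ e ⟫} {⟪ e′ ⟫} {fun α (inv α ⟪ e′ ⟫)} s (proj₂ (fun-inv α ⟪ e′ ⟫)))
    back : (∀ T → T ⊑ inv α ⟪ e′ ⟫) ⊎ (Ok e″ × inv α ⟪ e′ ⟫ ⊑ ⟪ e″ ⟫) → ⟪ e′ ⟫ ⊑ fun α ⟪ e ⟫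
    back (inj₁ full) = ⊥-elim (proper ok λ T → ⊑-trans {T} {fun α (inv α T)} {⟪ e′ ⟫} (proj₂ (fun-inv α T))
      (⊑-trans {fun α (inv α T)} {fun α (inv α ⟪ e′ ⟫)} {⟪ e′ ⟫} (mono α (full (inv α T))) (proj₁ (fun-inv α ⟪ e′ ⟫))))
    back (inj₂ (ok′ , s′)) = ⊑-trans {⟪ e′ ⟫} {fun α (inv α ⟪ e′ ⟫)} {fun α ⟪ e ⟫} (proj₂ (fun-inv α ⟪ e′ ⟫))
      (mono α (subst (λ x → inv α ⟪ e′ ⟫ ⊑ ⟪ x ⟫) (sym e≡e″) s′))
      where e≡e″ : e ≡ e″
            e≡e″ = antichain oe ok′ (⊑-trans {⟪ e ⟫} {inv α ⟪ e′ ⟫} {⟪ e″ ⟫} e⊑ s′)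

  opaque
    _♯ : Aut′ → Facet → Facet
    _♯ = imageFacet

    ♯-acts : ∀ α → Acts α (α ♯)
    ♯-acts = imageFacet-acts

  acts-unique : ∀ {α σ τ} → Acts α σ → Acts α τ → ∀ {e} → Ok e → σ e ≡ τ e
  acts-unique {α} {σ} {τ} a b {e} oe with a oe | b oe
  ... | o , p | o′ , q = antichain o o′ (proj₁ (≈-trans {⟪ σ e ⟫} {fun α ⟪ e ⟫} {⟪ τ e ⟫} (≈-sym {fun α ⟪ e ⟫} {⟪ σ e ⟫} p) q))

  acts-∘ : ∀ {α β σ τ} → Acts α σ → Acts β τ → Acts (α ∘A β) (σ ∘ τ)
  acts-∘ {α} {β} {σ} {τ} a b {e} oe with b oe
  ... | o , p with a o
  ...   | o′ , q = o′ , ≈-trans {fun α (fun β ⟪ e ⟫)} {fun α ⟪ τ e ⟫} {⟪ σ (τ e) ⟫} (fun-resp α {fun β ⟪ e ⟫} {⟪ τ e ⟫} p) q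

  acts-injective : ∀ {α β σ τ} → Acts α σ → Acts β τ → AutEq α β → ∀ {e} → Ok e → σ e ≡ τ e
  acts-injective {α} {β} {σ} {τ} a b eq = acts-unique {α} {σ} {τ} a
    (λ {e} oe → proj₁ (b oe) , ≈-trans {fun α ⟪ e ⟫} {fun β ⟪ e ⟫} {⟪ τ e ⟫} (Sub⇒⊑ (proj₁ (eq ⟪ e ⟫)) , Sub⇒⊑ (proj₂ (eq ⟪ e ⟫))) (proj₂ (b oe)))

  inverse-♯ : ∀ α {e} → Ok e → (α ♯) ((inverse α ♯) e) ≡ e
  inverse-♯ α {e} oe with ♯-acts (inverse α) oe
  ... | o , p with ♯-acts α o
  ...   | o′ , q = antichain o′ oe (⊑-trans {⟪ (α ♯) f ⟫} {fun α ⟪ f ⟫} {⟪ e ⟫} (proj₂ q)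
                     (⊑-trans {fun α ⟪ f ⟫} {fun α (inv α ⟪ e ⟫)} {⟪ e ⟫} (mono α (proj₂ p)) (proj₁ (fun-inv α ⟪ e ⟫))))
    where f = (inverse α ♯) e

  ♯-inverse : ∀ α {e} → Ok e → (inverse α ♯) ((α ♯) e) ≡ e
  ♯-inverse α {e} oe with ♯-acts α oe
  ... | o , p with ♯-acts (inverse α) o
  ...   | o′ , q = sym (antichain oe o′ (⊑-trans {⟪ e ⟫} {inv α ⟪ f ⟫} {⟪ (inverse α ♯) f ⟫}
                     (reflect α (⊑-trans {fun α ⟪ e ⟫} {⟪ f ⟫} {fun α (inv α ⟪ f ⟫)} (proj₁ p) (proj₂ (fun-inv α ⟪ f ⟫)))) (proj₁ q)))
    where f = (α ♯) e

  -- It suffices to treat the facets `f` containing `fun β S`. Such an `f` is the image under `β` of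
  -- a facet `e` containing `S`, and `α` sends `e` to the same `f`.
  acts-⊑ : ∀ {α β σ τ} → Acts α σ → Acts β τ → (∀ {e} → Ok e → σ e ≡ τ e) → ∀ S → fun α S ⊑ fun β S
  acts-⊑ {α} {β} {σ} {τ} a b eq S = meet-of-facets {fun α S} {fun β S} λ f of s →
    let e = (inverse β ♯) f
        oe = proj₁ (♯-acts (inverse β) of)
        τe≡f : τ e ≡ f
        τe≡f = trans (acts-unique {β} {τ} {β ♯} b (♯-acts β) oe) (inverse-♯ β of)
        S⊑e : S ⊑ ⟪ e ⟫
        S⊑e = reflect β (⊑-trans {fun β S} {⟪ f ⟫} {fun β ⟪ e ⟫} s (subst (λ x → ⟪ x ⟫ ⊑ fun β ⟪ e ⟫) τe≡f (proj₂ (proj₂ (b oe)))))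
    in subst (λ x → fun α S ⊑ ⟪ x ⟫) (trans (eq oe) τe≡f)
         (⊑-trans {fun α S} {fun α ⟪ e ⟫} {⟪ σ e ⟫} (mono α S⊑e) (proj₁ (proj₂ (a oe))))

  acts-≡ : ∀ {α β σ τ} → Acts α σ → Acts β τ → (∀ {e} → Ok e → σ e ≡ τ e) → AutEq α β
  acts-≡ {α} {β} {σ} {τ} a b eq S = ⊑⇒Sub (acts-⊑ {α} {β} {σ} {τ} a b eq S) , ⊑⇒Sub (acts-⊑ {β} {α} {τ} {σ} b a (λ oe → sym (eq oe)) S)

  -- By surjectivity the intersection of the two image facets is the image of a face `S`. Order
  -- reflection puts `S` in both `e` and `f`, hence in `g`.
  acts-meet : ∀ α {e f g} → Ok e → Ok f → Ok g → Meet A B e f g → Meet A B ((α ♯) e) ((α ♯) f) ((α ♯) g)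
  acts-meet α {e} {f} {g} oe of og m v mv te tf = In⇒tight₁ og′ (proj₁ q v mv (mono α S⊑g v mv (proj₂ S≈ v mv (tight⇒In (oe′ ∷ of′ ∷ []) (te ∷ tf ∷ [])))))
    where
    oe′ = proj₁ (♯-acts α oe)
    of′ = proj₁ (♯-acts α of)
    og′ = proj₁ (♯-acts α og)
    q = proj₂ (♯-acts α og)
    S′ = ⟦ (α ♯) e ∷ (α ♯) f ∷ [] ⟧
    S = inv α S′
    S≈ = fun-inv α S′
    S⊑ : ∀ {x} → Ok x → (∀ w → In w S′ → Tight A B w ((α ♯) x)) → S ⊑ ⟪ x ⟫
    S⊑ {x} ox h = reflect α λ w mw i → proj₂ (proj₂ (♯-acts α ox)) w mw (tight⇒In₁ (proj₁ (♯-acts α ox)) (h w (proj₁ S≈ w mw i)))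
    S⊑g : S ⊑ ⟪ g ⟫
    S⊑g w mw i = tight⇒In₁ og (m w mw
      (In⇒tight₁ oe (S⊑ oe (λ w i → All.head (In⇒tight (oe′ ∷ of′ ∷ []) i)) w mw i))
      (In⇒tight₁ of (S⊑ of (λ w i → All.head (All.tail (In⇒tight (oe′ ∷ of′ ∷ []) i))) w mw i)))

  ♯-injective : ∀ α {e f} → Ok e → Ok f → (α ♯) e ≡ (α ♯) f → e ≡ f
  ♯-injective α oe of p = trans (sym (♯-inverse α oe)) (trans (cong (inverse α ♯) p) (♯-inverse α of))

  ♯-opp : ∀ α {e f g} → Opp A B e f g → Opp A B ((α ♯) e) ((α ♯) f) ((α ♯) g)
  ♯-opp α {e} {f} {g} o = classify A B (ok oe) (ok of) (ok og)
      (λ p → proj₁ (opp-distinct o) (♯-injective α og oe p)) (λ p → proj₂ (opp-distinct o) (♯-injective α og of p))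
      (acts-meet α oe of og (opp⇒meet A B o))
    where
    ok : ∀ {e} → Ok e → Ok ((α ♯) e)
    ok oe = proj₁ (♯-acts α oe)
    oe = pair-valid (pair-sym (opp⇒pair o))
    of = pair-valid (opp⇒pair o)
    og = opp-valid o

  iso : Aut′ → Iso A B A B
  iso α = record
    { to = α ♯ ; from = inverse α ♯
    ; to-valid = λ o → proj₁ (♯-acts α o) ; from-valid = λ o → proj₁ (♯-acts (inverse α) o)
    ; from-to = ♯-inverse α ; to-from = inverse-♯ α
    ; to-opp = ♯-opp α ; from-opp = ♯-opp (inverse α) }

  -- `move` acts on vertices and `σ` pulls facets back along it; for an involution the direction is
  -- immaterial. Applying `move` twice is compared with the identity through tight facets only, so
  -- values outside the grid may change.
  record Symmetry (σ : Facet → Facet) : Set where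
    field
      move       : Filling → Filling
      move-mono  : ∀ {v} → Mono v → Mono (move v)
      ok         : ∀ {e} → Ok e → Ok (σ e)
      involutive : ∀ {e} → Ok e → σ (σ e) ≡ e
      move-tight : ∀ {v e} → Mono v → Ok e → tight A B (move v) e ≡ tight A B v (σ e)

  module _ {σ : Facet → Facet} (Σσ : Symmetry σ) where
    open Symmetry Σσ

    private
      image : EdgeSet n → EdgeSet n
      image S = ⟦ map σ (facetsOf S) ⟧

      ok-image : ∀ S → All Ok (map σ (facetsOf S))
      ok-image S = All.map⁺ (All.map ok (valid (described-In S)))

      image⇒ : ∀ {v S} → Mono v → In v (image S) → In (move v) S
      image⇒ {v} {S} m i = ⇐ (described-In S) (move-mono m)
        (All.zipWith (λ (o , t) → trans (move-tight m o) t) (valid (described-In S) , All.map⁻ (In⇒tight (ok-image S) i)))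

      image⇐ : ∀ {v S} → Mono v → In (move v) S → In v (image S)
      image⇐ {v} {S} m i = tight⇒In (ok-image S) (All.map⁺
        (All.zipWith (λ (o , t) → trans (sym (move-tight m o)) t) (valid (described-In S) , ⇒ (described-In S) (move-mono m) i)))

      tight-twice : ∀ {v e} → Mono v → Ok e → tight A B (move (move v)) e ≡ tight A B v e
      tight-twice {v} m o = trans (move-tight (move-mono m) o) (trans (move-tight m (ok o)) (cong (tight A B v) (involutive o)))

      twice⇒ : ∀ {v} S → Mono v → In (move (move v)) S → In v S
      twice⇒ S m i = ⇐ (described-In S) m (All.zipWith (λ (o , t) → trans (sym (tight-twice m o)) t)
        (valid (described-In S) , ⇒ (described-In S) (move-mono (move-mono m)) i))

      twice⇐ : ∀ {v} S → Mono v → In v S → In (move (move v)) S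
      twice⇐ S m i = ⇐ (described-In S) (move-mono (move-mono m)) (All.zipWith (λ (o , t) → trans (tight-twice m o) t)
        (valid (described-In S) , ⇒ (described-In S) m i))

    opaque
      symmetry : Aut′
      symmetry = record
        { fun = image
        ; monoRefl = λ S T → (λ s → ⊑⇒Sub λ v m i → image⇐ {v} {T} m (Sub⇒⊑ s (move v) (move-mono m) (image⇒ {v} {S} m i)))
                           , (λ s → ⊑⇒Sub λ v m i → twice⇒ T m (image⇒ {move v} {T} (move-mono m)
                                      (Sub⇒⊑ s (move v) (move-mono m) (image⇐ {move v} {S} (move-mono m) (twice⇐ S m i)))))
        ; surj = λ T → image T , ⊑⇒Sub (λ v m i → twice⇒ T m (image⇒ {move v} {T} (move-mono m) (image⇒ {v} {image T} m i)))
                               , ⊑⇒Sub (λ v m i → image⇐ {v} {image T} m (image⇐ {move v} {T} (move-mono m) (twice⇐ T m i))) }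

      symmetry-acts : Acts symmetry σ
      symmetry-acts {e} o = ok o
        , (λ v m i → tight⇒In₁ (ok o) (trans (sym (move-tight m o)) (In⇒tight₁ o (image⇒ {v} {⟪ e ⟫} m i))))
        , (λ v m i → image⇐ {v} {⟪ e ⟫} m (tight⇒In₁ o (trans (move-tight m o) (In⇒tight₁ (ok o) i))))

  idA : Aut′
  idA = record { fun = id ; monoRefl = λ S T → id , id ; surj = λ T → T , (λ x p → p) , (λ x p → p) }

  idA-acts : Acts idA id
  idA-acts {e} o = o , ≈-refl {⟪ e ⟫}

-- Symmetries generating the automorphism group

twistH twistV : ℕ → ℕ → Facet
twistH zero    zero    = V 0 0
twistH zero    (suc i) = H (suc i) 0
twistH (suc k) i       = H i (suc k)
twistV zero    zero    = H 0 0
twistV zero    (suc k) = V 0 (suc k)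
twistV (suc i) k       = V (suc i) k

twist : Facet → Facet
twist bot     = bot
twist top     = top
twist (H i k) = twistH k i
twist (V i k) = twistV i k

twist-involutive : ∀ e → twist (twist e) ≡ e
twist-involutive bot             = refl
twist-involutive top             = refl
twist-involutive (H zero zero)   = refl
twist-involutive (H (suc _) zero) = refl
twist-involutive (H _ (suc _))   = refl
twist-involutive (V zero zero)   = refl
twist-involutive (V zero (suc _)) = refl
twist-involutive (V (suc _) _)   = refl

swapApex : Facet → Facet
swapApex bot     = top
swapApex top     = bot
swapApex (H i k) = H i k
swapApex (V i k) = V i k

swapApex-involutive : ∀ e → swapApex (swapApex e) ≡ e
swapApex-involutive bot     = refl
swapApex-involutive top     = refl
swapApex-involutive (H _ _) = refl
swapApex-involutive (V _ _) = refl

eqb-comm : ∀ x y → eqb x y ≡ eqb y x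
eqb-comm false false = refl
eqb-comm false true  = refl
eqb-comm true  false = refl
eqb-comm true  true  = refl

∸-step : ∀ {m n} → m < n → n ∸ m ≡ suc (n ∸ suc m)
∸-step p = +-∸-assoc 1 p

module Generators (a b : ℕ) where

  A B : ℕ
  A = suc a
  B = suc b

  open Faces A B public

  twist-symmetry : Symmetry twist
  twist-symmetry = record
    { move = move ; move-mono = move-mono ; ok = λ {e} → ok e ; involutive = λ {e} _ → twist-involutive e
    ; move-tight = λ {v} {e} _ _ → move-tight v e }
    where
    move : Filling → Filling
    -- Modulo 2 this is `x + y - c`, the reflection of the entry `c` between its neighbours
    -- `x ≤ c ≤ y`.
    move v zero    zero    = v 0 1 xor (v 1 0 xor v 0 0)
    move v zero    (suc k) = v 0 (suc k)
    move v (suc i) k       = v (suc i) k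

    reflect-≤ : ∀ {x c y} → (x ≡ true → c ≡ true) → (c ≡ true → y ≡ true) → (x xor (y xor c)) ≡ true → y ≡ true
    reflect-≤ {y = true} _ _ _ = refl
    reflect-≤ {false} {false} {false} _ _ ()
    reflect-≤ {false} {true}  {false} _ g _ = g refl
    reflect-≤ {true}  {false} {false} f g _ = g (f refl)
    reflect-≤ {true}  {true}  {false} _ g _ = g refl

    reflect-≥ : ∀ {x c y} → (x ≡ true → c ≡ true) → (c ≡ true → y ≡ true) → x ≡ true → (x xor (y xor c)) ≡ true
    reflect-≥ {true} {c} {y} f g refl rewrite f refl | g refl = refl

    move-mono : ∀ {v} → Mono v → Mono (move v)
    move-mono {v} (m₁ , m₂) = m₁′ , m₂′
      where
      m₁′ : ∀ i k → i < A → k ≤ B → move v i k ≡ true → move v (suc i) k ≡ true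
      m₁′ zero    zero    p q = reflect-≤ (m₂ 0 0 z≤n (s≤s z≤n)) (m₁ 0 0 p q)
      m₁′ zero    (suc k) p q = m₁ 0 (suc k) p q
      m₁′ (suc i) k       p q = m₁ (suc i) k p q
      m₂′ : ∀ i k → i ≤ A → k < B → move v i (suc k) ≡ true → move v i k ≡ true
      m₂′ zero    zero    p q = reflect-≥ (m₂ 0 0 p q) (m₁ 0 0 (s≤s z≤n) z≤n)
      m₂′ zero    (suc k) p q = m₂ 0 (suc k) p q
      m₂′ (suc i) k       p q = m₂ (suc i) k p q

    ok : ∀ e → Ok e → Ok (twist e)
    ok bot              o = o
    ok top              o = o
    ok (H zero zero)    _ = z≤n , s≤s z≤n
    ok (H (suc _) zero) o = o
    ok (H _ (suc _))    o = o
    ok (V zero zero)    _ = s≤s z≤n , z≤n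
    ok (V zero (suc _)) o = o
    ok (V (suc _) _)    o = o

    corner-H : ∀ x y c → eqb (x xor (y xor c)) y ≡ eqb c x
    corner-H false false false = refl
    corner-H false false true  = refl
    corner-H false true  false = refl
    corner-H false true  true  = refl
    corner-H true  false false = refl
    corner-H true  false true  = refl
    corner-H true  true  false = refl
    corner-H true  true  true  = refl

    corner-V : ∀ x y c → eqb (x xor (y xor c)) x ≡ eqb c y
    corner-V false false false = refl
    corner-V false false true  = refl
    corner-V false true  false = refl
    corner-V false true  true  = refl
    corner-V true  false false = refl
    corner-V true  false true  = refl
    corner-V true  true  false = refl
    corner-V true  true  true  = refl

    move-tight : ∀ v e → tight A B (move v) e ≡ tight A B v (twist e)
    move-tight v bot                    = refl
    move-tight v top                    = refl
    move-tight v (H zero zero)          = corner-H (v 0 1) (v 1 0) (v 0 0)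
    move-tight v (H (suc _) zero)       = refl
    move-tight v (H zero (suc _))       = refl
    move-tight v (H (suc _) (suc _))    = refl
    move-tight v (V zero zero)          = corner-V (v 0 1) (v 1 0) (v 0 0)
    move-tight v (V zero (suc _))       = refl
    move-tight v (V (suc _) _)          = refl

  rotate : Facet → Facet
  rotate bot     = top
  rotate top     = bot
  rotate (H i k) = H (A ∸ suc i) (B ∸ k)
  rotate (V i k) = V (A ∸ i) (B ∸ suc k)

  rotate-ok : ∀ {e} → Ok e → Ok (rotate e)
  rotate-ok {bot}   _       = tt
  rotate-ok {top}   _       = tt
  rotate-ok {H i k} (p , q) = s≤s (m∸n≤m a i) , m∸n≤m B k
  rotate-ok {V i k} (p , q) = m∸n≤m A i , s≤s (m∸n≤m b k)

  rotate-involutive : ∀ {e} → Ok e → rotate (rotate e) ≡ e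
  rotate-involutive {bot}   _       = refl
  rotate-involutive {top}   _       = refl
  rotate-involutive {H i k} (p , q) = cong₂ H (m∸[m∸n]≡n (s≤s⁻¹ p)) (m∸[m∸n]≡n q)
  rotate-involutive {V i k} (p , q) = cong₂ V (m∸[m∸n]≡n p) (m∸[m∸n]≡n (s≤s⁻¹ q))

  rotate-symmetry : Symmetry rotate
  rotate-symmetry = record
    { move = move ; move-mono = move-mono ; ok = rotate-ok ; involutive = rotate-involutive
    ; move-tight = λ {v} {e} _ → move-tight v e }
    where
    move : Filling → Filling
    -- As for `flip`, the complement compensates for the order reversal of the half turn.
    move v i k = not (v (A ∸ i) (B ∸ k))

    move-mono : ∀ {v} → Mono v → Mono (move v)
    move-mono {v} (m₁ , m₂) = (λ i k p q → not-anti (λ t → subst (λ j → v j (B ∸ k) ≡ true) (sym (∸-step p)) (m₁ (A ∸ suc i) (B ∸ k) (s≤s (m∸n≤m a i)) (m∸n≤m B k) t)))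
                            , (λ i k p q → not-anti (λ t → m₂ (A ∸ i) (B ∸ suc k) (m∸n≤m A i) (s≤s (m∸n≤m b k)) (subst (λ j → v (A ∸ i) j ≡ true) (∸-step q) t)))

    move-tight : ∀ v e → Ok e → tight A B (move v) e ≡ tight A B v (rotate e)
    move-tight v bot _ = trans (not-involutive _) (cong (v A) (n∸n≡0 B))
    move-tight v top _ = cong (λ j → not (v j B)) (n∸n≡0 A)
    move-tight v (H i k) (p , q) = trans (eqb-not (v (A ∸ i) (B ∸ k)) (v (A ∸ suc i) (B ∸ k)))
      (trans (eqb-comm (v (A ∸ i) (B ∸ k)) (v (A ∸ suc i) (B ∸ k))) (cong (λ j → eqb (v (A ∸ suc i) (B ∸ k)) (v j (B ∸ k))) (∸-step p)))
    move-tight v (V i k) (p , q) = trans (eqb-not (v (A ∸ i) (B ∸ k)) (v (A ∸ i) (B ∸ suc k)))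
      (trans (eqb-comm (v (A ∸ i) (B ∸ k)) (v (A ∸ i) (B ∸ suc k))) (cong (λ j → eqb (v (A ∸ i) (B ∸ suc k)) (v (A ∸ i) j)) (∸-step q)))

  -- The vertices on which v 0 B ≡ v A 0 are the two constant fillings, the apexes of a double pyramid; they are exchanged.
  apex-symmetry : Symmetry swapApex
  apex-symmetry = record
    { move = move ; move-mono = move-mono ; ok = λ {e} → ok e ; involutive = λ {e} _ → swapApex-involutive e
    ; move-tight = λ {v} {e} _ _ → move-tight v e }
    where
    move : Filling → Filling
    move v i k = v i k xor eqb (v 0 B) (v A 0)

    up : ∀ {v} → Mono v → ∀ d i k → d + i ≤ A → k ≤ B → v i k ≡ true → v (d + i) k ≡ true
    up m zero    i k p q t = t
    up m (suc d) i k p q t = proj₁ m (d + i) k p q (up m d i k (<⇒≤ p) q t)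

    down : ∀ {v} → Mono v → ∀ d i k → i ≤ A → d + k ≤ B → v i (d + k) ≡ true → v i k ≡ true
    down m zero    i k p q t = t
    down m (suc d) i k p q t = down m d i k p (<⇒≤ q) (proj₂ m i (d + k) p q t)

    constant : ∀ {v} → Mono v → v 0 B ≡ v A 0 → ∀ {i k} → i ≤ A → k ≤ B → v i k ≡ v 0 B
    constant {v} m eq {i} {k} p q = sandwich lower upper eq
      where
      lower : v 0 B ≡ true → v i k ≡ true
      lower t = subst (λ j → v j k ≡ true) (+-identityʳ i) (up {v} m i 0 k (subst (_≤ A) (sym (+-identityʳ i)) p) q
                  (down {v} m (B ∸ k) 0 k z≤n (≤-reflexive (m∸n+n≡m q)) (subst (λ j → v 0 j ≡ true) (sym (m∸n+n≡m q)) t)))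
      upper : v i k ≡ true → v A 0 ≡ true
      upper t = subst (λ j → v j 0 ≡ true) (m∸n+n≡m p) (up {v} m (A ∸ i) i 0 (≤-reflexive (m∸n+n≡m p)) z≤n
                  (down {v} m k i 0 p (subst (_≤ B) (sym (+-identityʳ k)) q) (subst (λ j → v i j ≡ true) (sym (+-identityʳ k)) t)))

    -- A complement reverses the order, so it is compatible with it only when the two entries agree;
    -- where it is applied the filling is constant.
    xor-mono : ∀ {x y} c → (x ≡ true → y ≡ true) → (c ≡ true → x ≡ y) → (x xor c) ≡ true → (y xor c) ≡ true
    xor-mono {x} true  f g t = subst (λ z → (z xor true) ≡ true) (g refl) t
    xor-mono {true}  {y} false f g t rewrite f refl = refl

    move-mono : ∀ {v} → Mono v → Mono (move v)
    move-mono {v} m@(m₁ , m₂) =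
        (λ i k p q → xor-mono (eqb (v 0 B) (v A 0)) (m₁ i k p q) (λ c → same c (<⇒≤ p) q p q))
      , (λ i k p q → xor-mono (eqb (v 0 B) (v A 0)) (m₂ i k p q) (λ c → same c p q p (<⇒≤ q)))
      where
      same : eqb (v 0 B) (v A 0) ≡ true → ∀ {i k j l} → i ≤ A → k ≤ B → j ≤ A → l ≤ B → v i k ≡ v j l
      same c p q r s = trans (constant {v} m (eqb⇒≡ c) p q) (sym (constant {v} m (eqb⇒≡ c) r s))

    ok : ∀ e → Ok e → Ok (swapApex e)
    ok bot     _ = tt
    ok top     _ = tt
    ok (H _ _) o = o
    ok (V _ _) o = o

    eqb-xor : ∀ x y c → eqb (x xor c) (y xor c) ≡ eqb x y
    eqb-xor false false false = refl
    eqb-xor false false true  = refl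
    eqb-xor false true  false = refl
    eqb-xor false true  true  = refl
    eqb-xor true  false false = refl
    eqb-xor true  false true  = refl
    eqb-xor true  true  false = refl
    eqb-xor true  true  true  = refl

    xor-bot : ∀ x y → not (x xor eqb x y) ≡ y
    xor-bot false false = refl
    xor-bot false true  = refl
    xor-bot true  false = refl
    xor-bot true  true  = refl

    xor-top : ∀ x y → (y xor eqb x y) ≡ not x
    xor-top false false = refl
    xor-top false true  = refl
    xor-top true  false = refl
    xor-top true  true  = refl

    move-tight : ∀ v e → tight A B (move v) e ≡ tight A B v (swapApex e)
    move-tight v bot     = xor-bot (v 0 B) (v A 0)
    move-tight v top     = xor-top (v 0 B) (v A 0)
    move-tight v (H i k) = eqb-xor (v i k) (v (suc i) k) (eqb (v 0 B) (v A 0))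
    move-tight v (V i k) = eqb-xor (v i k) (v i (suc k)) (eqb (v 0 B) (v A 0))

  -- The dihedral group generated by `twist` and `rotate`, and its product with `swapApex`

  turn : Facet → Facet
  turn e = twist (rotate e)

  -- The facets at `(0 , 0)` and at `(A , B)`, listed in the cyclic order in which `turn` permutes
  -- them. In this labelling `rotate` is the reflection sending `z` to `r1 - z`.
  corner : Z4 → Facet
  corner r0 = H 0 0
  corner r1 = H a B
  corner r2 = V 0 0
  corner r3 = V A b

  corner-ok : ∀ z → Ok (corner z)
  corner-ok r0 = s≤s z≤n , z≤n
  corner-ok r1 = ≤-refl , ≤-refl
  corner-ok r2 = z≤n , s≤s z≤n
  corner-ok r3 = ≤-refl , ≤-refl

  corner-injective : ∀ z w → corner z ≡ corner w → z ≡ w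
  corner-injective r0 r0 _ = refl
  corner-injective r0 r1 ()
  corner-injective r0 r2 ()
  corner-injective r0 r3 ()
  corner-injective r1 r0 ()
  corner-injective r1 r1 _ = refl
  corner-injective r1 r2 ()
  corner-injective r1 r3 ()
  corner-injective r2 r0 ()
  corner-injective r2 r1 ()
  corner-injective r2 r2 _ = refl
  corner-injective r2 r3 ()
  corner-injective r3 r0 ()
  corner-injective r3 r1 ()
  corner-injective r3 r2 ()
  corner-injective r3 r3 _ = refl

  rotate-corner : ∀ z → rotate (corner z) ≡ corner (r1 +Z4 negZ4 z)
  rotate-corner r0 = refl
  rotate-corner r1 = cong₂ H (n∸n≡0 a) (n∸n≡0 b)
  rotate-corner r2 = refl
  rotate-corner r3 = cong₂ V (n∸n≡0 a) (n∸n≡0 b)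

  turn-corner : ∀ z → turn (corner z) ≡ corner (sucZ4 z)
  turn-corner r0 = refl
  turn-corner r1 = cong twist (rotate-corner r1)
  turn-corner r2 = refl
  turn-corner r3 = cong twist (rotate-corner r3)

  Inner : Facet → Set
  Inner e = twist e ≡ e × twist (rotate e) ≡ rotate e

  corner-or-inner : ∀ {e} → Ok e → (∃ λ z → e ≡ corner z) ⊎ Inner e
  corner-or-inner {bot} _ = inj₂ (refl , refl)
  corner-or-inner {top} _ = inj₂ (refl , refl)
  corner-or-inner {H zero zero}    _ = inj₁ (r0 , refl)
  corner-or-inner {H (suc i) zero} _ = inj₂ (refl , refl)
  corner-or-inner {H i (suc k)} (p , q) with a ∸ i in eq | b ∸ k in eq′
  ... | zero  | zero  = inj₁ (r1 , cong₂ H (≤-antisym (s≤s⁻¹ p) (m∸n≡0⇒m≤n eq)) (≤-antisym q (s≤s (m∸n≡0⇒m≤n eq′))))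
  ... | suc _ | zero  = inj₂ (refl , refl)
  ... | _     | suc _ = inj₂ (refl , refl)
  corner-or-inner {V zero zero}    _ = inj₁ (r2 , refl)
  corner-or-inner {V zero (suc k)} _ = inj₂ (refl , refl)
  corner-or-inner {V (suc i) k} (p , q) with a ∸ i in eq | b ∸ k in eq′
  ... | zero  | zero  = inj₁ (r3 , cong₂ V (≤-antisym p (s≤s (m∸n≡0⇒m≤n eq))) (≤-antisym (s≤s⁻¹ q) (m∸n≡0⇒m≤n eq′)))
  ... | zero  | suc _ = inj₂ (refl , refl)
  ... | suc _ | _     = inj₂ (refl , refl)

  -- On an inner facet `turn` agrees with `rotate` and already squares to the identity; the four
  -- corners form one cycle.
  turn⁴ : ∀ {e} → Ok e → turn (turn (turn (turn e))) ≡ e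
  turn⁴ {e} o with corner-or-inner o
  ... | inj₂ (p , q) = trans (cong (turn ∘ turn) square) square
    where square : turn (turn e) ≡ e
          square = trans (cong turn q) (trans (cong twist (rotate-involutive o)) p)
  ... | inj₁ (z , refl) = trans (cong (turn ∘ turn ∘ turn) (turn-corner z)) (trans (cong (turn ∘ turn) (turn-corner (sucZ4 z)))
                            (trans (cong turn (turn-corner (sucZ4 (sucZ4 z)))) (trans (turn-corner (sucZ4 (sucZ4 (sucZ4 z)))) (cong corner (suc⁴ z)))))
    where suc⁴ : ∀ z → sucZ4 (sucZ4 (sucZ4 (sucZ4 z))) ≡ z
          suc⁴ r0 = refl
          suc⁴ r1 = refl
          suc⁴ r2 = refl
          suc⁴ r3 = refl

  twist-ok : ∀ {e} → Ok e → Ok (twist e)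
  twist-ok = Symmetry.ok twist-symmetry

  swapApex-ok : ∀ {e} → Ok e → Ok (swapApex e)
  swapApex-ok = Symmetry.ok apex-symmetry

  turn-ok : ∀ {e} → Ok e → Ok (turn e)
  turn-ok o = twist-ok (rotate-ok o)

  turns : Z4 → Facet → Facet
  turns r0 e = e
  turns r1 e = turn e
  turns r2 e = turn (turn e)
  turns r3 e = turn (turn (turn e))

  turns-ok : ∀ z {e} → Ok e → Ok (turns z e)
  turns-ok r0 o = o
  turns-ok r1 o = turn-ok o
  turns-ok r2 o = turn-ok (turn-ok o)
  turns-ok r3 o = turn-ok (turn-ok (turn-ok o))

  turns-suc : ∀ z {e} → Ok e → turns (sucZ4 z) e ≡ turn (turns z e)
  turns-suc r0 _ = refl
  turns-suc r1 _ = refl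
  turns-suc r2 _ = refl
  turns-suc r3 o = sym (turn⁴ o)

  turns-+ : ∀ z w {e} → Ok e → turns (z +Z4 w) e ≡ turns z (turns w e)
  turns-+ r0 w o = refl
  turns-+ r1 w o = turns-suc w o
  turns-+ r2 w o = trans (turns-suc (sucZ4 w) o) (cong turn (turns-suc w o))
  turns-+ r3 w o = trans (turns-suc (sucZ4 (sucZ4 w)) o) (cong turn (turns-+ r2 w o))

  -- `turn` is a product of two involutions, one of them `rotate`, so conjugation by `rotate`
  -- inverts it; its inverse is `turns r3`.
  rotate-turn : ∀ {e} → Ok e → rotate (turn e) ≡ turns r3 (rotate e)
  rotate-turn {e} o = trans (sym (turn⁴ (rotate-ok (turn-ok o)))) (cong (turn ∘ turn ∘ turn)
    (trans (cong twist (rotate-involutive (turn-ok o))) (twist-involutive (rotate e))))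

  rotate-turns : ∀ z {e} → Ok e → rotate (turns z e) ≡ turns (negZ4 z) (rotate e)
  rotate-turns r0 o = refl
  rotate-turns r1 o = rotate-turn o
  rotate-turns r2 o = trans (rotate-turn (turn-ok o)) (trans (cong (turns r3) (rotate-turn o)) (sym (turns-+ r3 r3 (rotate-ok o))))
  rotate-turns r3 o = trans (rotate-turn (turns-ok r2 o)) (trans (cong (turns r3) (rotate-turns r2 o)) (sym (turns-+ r3 r2 (rotate-ok o))))

  dihedral : Z4 × Bool → Facet → Facet
  dihedral (z , false) e = turns z e
  dihedral (z , true)  e = turns z (rotate e)

  dihedral-hom : ∀ g h {e} → Ok e → dihedral (_·_ D4 g h) e ≡ dihedral g (dihedral h e)
  dihedral-hom (z , false) (w , false) o = turns-+ z w o
  dihedral-hom (z , false) (w , true)  o = turns-+ z w (rotate-ok o)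
  dihedral-hom (z , true)  (w , false) o = trans (turns-+ z (negZ4 w) (rotate-ok o)) (cong (turns z) (sym (rotate-turns w o)))
  dihedral-hom (z , true)  (w , true) {e} o = trans (turns-+ z (negZ4 w) o) (cong (turns z)
    (trans (cong (turns (negZ4 w)) (sym (rotate-involutive o))) (sym (rotate-turns w (rotate-ok o)))))

  turns-commute : ∀ {f : Facet → Facet} → (∀ {e} → Ok e → f (turn e) ≡ turn (f e)) → ∀ z {e} → Ok e → f (turns z e) ≡ turns z (f e)
  turns-commute c r0 o = refl
  turns-commute c r1 o = c o
  turns-commute c r2 o = trans (c (turn-ok o)) (cong turn (c o))
  turns-commute c r3 o = trans (c (turns-ok r2 o)) (cong turn (trans (c (turn-ok o)) (cong turn (c o))))

  dihedral-commute : ∀ {f : Facet → Facet} → (∀ {e} → Ok e → f (rotate e) ≡ rotate (f e)) → (∀ {e} → Ok e → f (twist e) ≡ twist (f e)) →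
                     ∀ g {e} → Ok e → f (dihedral g e) ≡ dihedral g (f e)
  dihedral-commute {f} c d (z , false) o = turns-commute {f} (λ o → trans (d (rotate-ok o)) (cong twist (c o))) z o
  dihedral-commute {f} c d (z , true)  o = trans (turns-commute {f} (λ o → trans (d (rotate-ok o)) (cong twist (c o))) z (rotate-ok o)) (cong (turns z) (c o))

  swapApex-rotate : ∀ e → swapApex (rotate e) ≡ rotate (swapApex e)
  swapApex-rotate bot     = refl
  swapApex-rotate top     = refl
  swapApex-rotate (H _ _) = refl
  swapApex-rotate (V _ _) = refl

  swapApex-twist : ∀ e → swapApex (twist e) ≡ twist (swapApex e)
  swapApex-twist bot              = refl
  swapApex-twist top              = refl
  swapApex-twist (H zero zero)    = refl
  swapApex-twist (H (suc _) zero) = refl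
  swapApex-twist (H _ (suc _))    = refl
  swapApex-twist (V zero zero)    = refl
  swapApex-twist (V zero (suc _)) = refl
  swapApex-twist (V (suc _) _)    = refl

  power : (Facet → Facet) → Bool → Facet → Facet
  power f true  e = f e
  power f false e = e

  power-xor : ∀ {f} → (∀ e → f (f e) ≡ e) → ∀ x y e → power f (x xor y) e ≡ power f x (power f y e)
  power-xor i false y     e = refl
  power-xor i true  false e = refl
  power-xor i true  true  e = sym (i e)

  power-commute : ∀ {f} {g : Facet → Facet} → (∀ {e} → Ok e → f (g e) ≡ g (f e)) → ∀ x {e} → Ok e → power f x (g e) ≡ g (power f x e)
  power-commute c true  o = c o
  power-commute c false o = refl

  action : (Z4 × Bool) × Bool → Facet → Facet
  action (d , c) e = dihedral d (power swapApex c e)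

  power-swapApex-ok : ∀ c {e} → Ok e → Ok (power swapApex c e)
  power-swapApex-ok true  o = swapApex-ok o
  power-swapApex-ok false o = o

  swapApex-dihedral : ∀ c d {e} → Ok e → power swapApex c (dihedral d e) ≡ dihedral d (power swapApex c e)
  swapApex-dihedral c d = power-commute (λ o → dihedral-commute {swapApex} (λ {e} _ → swapApex-rotate e) (λ {e} _ → swapApex-twist e) d o) c

  action-hom : ∀ g h {e} → Ok e → action (_·_ (D4 ⊗ Z2) g h) e ≡ action g (action h e)
  action-hom (d , c) (d′ , c′) {e} o = trans (dihedral-hom d d′ (power-swapApex-ok (c xor c′) o)) (cong (dihedral d)
    (trans (cong (dihedral d′) (power-xor swapApex-involutive c c′ e)) (sym (swapApex-dihedral c d′ (power-swapApex-ok c′ o)))))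

  twist-aut rotate-aut apex-aut turn-aut : Aut′
  twist-aut  = symmetry twist-symmetry
  rotate-aut = symmetry rotate-symmetry
  apex-aut   = symmetry apex-symmetry
  turn-aut   = twist-aut ∘A rotate-aut

  turn-acts : Acts turn-aut turn
  turn-acts = acts-∘ {twist-aut} {rotate-aut} {twist} {rotate} (symmetry-acts twist-symmetry) (symmetry-acts rotate-symmetry)

  turns-aut : Z4 → Aut′
  turns-aut r0 = idA
  turns-aut r1 = turn-aut
  turns-aut r2 = turn-aut ∘A turn-aut
  turns-aut r3 = turn-aut ∘A (turn-aut ∘A turn-aut)

  turns-acts : ∀ z → Acts (turns-aut z) (turns z)
  turns-acts r0 = idA-acts
  turns-acts r1 = turn-acts
  turns-acts r2 = acts-∘ {turn-aut} {turn-aut} {turn} {turn} turn-acts turn-acts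
  turns-acts r3 = acts-∘ {turn-aut} {turns-aut r2} {turn} {turns r2} turn-acts (acts-∘ {turn-aut} {turn-aut} {turn} {turn} turn-acts turn-acts)

  power-aut : Aut′ → Bool → Aut′
  power-aut α true  = α
  power-aut α false = idA

  power-acts : ∀ {α σ} → Acts α σ → ∀ c → Acts (power-aut α c) (power σ c)
  power-acts s true  = s
  power-acts s false = idA-acts

  opaque
    action-aut : (Z4 × Bool) × Bool → Aut′
    action-aut ((z , s) , c) = (turns-aut z ∘A power-aut rotate-aut s) ∘A power-aut apex-aut c

    action-acts : ∀ g → Acts (action-aut g) (action g)
    action-acts ((z , s) , c) = acts-∘ {turns-aut z ∘A power-aut rotate-aut s} {power-aut apex-aut c} {dihedral (z , s)} {power swapApex c}
      (dihedral-acts s) (power-acts {apex-aut} {swapApex} (symmetry-acts apex-symmetry) c)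
      where
      dihedral-acts : ∀ s → Acts (turns-aut z ∘A power-aut rotate-aut s) (dihedral (z , s))
      dihedral-acts false = acts-∘ {turns-aut z} {idA} {turns z} {id} (turns-acts z) idA-acts
      dihedral-acts true  = acts-∘ {turns-aut z} {rotate-aut} {turns z} {rotate} (turns-acts z) (symmetry-acts rotate-symmetry)

  act₄ : Z4 × Bool → Z4 → Z4
  act₄ (z , false) w = z +Z4 w
  act₄ (z , true)  w = z +Z4 (r1 +Z4 negZ4 w)

  turns-corner : ∀ z w → turns z (corner w) ≡ corner (z +Z4 w)
  turns-corner r0 w = refl
  turns-corner r1 w = turn-corner w
  turns-corner r2 w = trans (cong turn (turn-corner w)) (turn-corner (sucZ4 w))
  turns-corner r3 w = trans (cong turn (turns-corner r2 w)) (turn-corner (sucZ4 (sucZ4 w)))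

  dihedral-corner : ∀ d w → dihedral d (corner w) ≡ corner (act₄ d w)
  dihedral-corner (z , false) w = turns-corner z w
  dihedral-corner (z , true)  w = trans (cong (turns z) (rotate-corner w)) (turns-corner z (r1 +Z4 negZ4 w))

  swapApex-corner : ∀ c z → power swapApex c (corner z) ≡ corner z
  swapApex-corner false z  = refl
  swapApex-corner true  r0 = refl
  swapApex-corner true  r1 = refl
  swapApex-corner true  r2 = refl
  swapApex-corner true  r3 = refl

  follows : Z4 → Z4 → Bool
  follows r0 r1 = true
  follows r1 r2 = true
  follows r2 r3 = true
  follows r3 r0 = true
  follows _  _  = false

  -- Reads a dihedral element off the images of corners `r0` and `r1`. The rotation by `z` sends
  -- them to `z` and its successor; `(z , true)` sends `r0` to the successor of `z` and `r1` to `z`,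
  -- so the second image is then the rotation part.
  decode : Z4 → Z4 → Z4 × Bool
  decode z w with follows z w
  ... | true  = z , false
  ... | false = w , true

  decode-act₄ : ∀ d → decode (act₄ d r0) (act₄ d r1) ≡ d
  decode-act₄ (r0 , false) = refl
  decode-act₄ (r1 , false) = refl
  decode-act₄ (r2 , false) = refl
  decode-act₄ (r3 , false) = refl
  decode-act₄ (r0 , true)  = refl
  decode-act₄ (r1 , true)  = refl
  decode-act₄ (r2 , true)  = refl
  decode-act₄ (r3 , true)  = refl

  dihedral-injective : ∀ d d′ → (∀ z → dihedral d (corner z) ≡ dihedral d′ (corner z)) → d ≡ d′
  dihedral-injective d d′ eq = trans (sym (decode-act₄ d)) (trans (cong₂ decode (same r0) (same r1)) (decode-act₄ d′))
    where same : ∀ z → act₄ d z ≡ act₄ d′ z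
          same z = corner-injective (act₄ d z) (act₄ d′ z) (trans (sym (dihedral-corner d z)) (trans (eq z) (dihedral-corner d′ z)))

  data Apex : Facet → Set where
    bot : Apex bot
    top : Apex top

  rotate-apex : ∀ {e} → Apex e → Apex (rotate e)
  rotate-apex bot = top
  rotate-apex top = bot

  turn-apex : ∀ {e} → Apex e → Apex (turn e)
  turn-apex bot = top
  turn-apex top = bot

  turns-apex : ∀ z {e} → Apex e → Apex (turns z e)
  turns-apex r0 p = p
  turns-apex r1 p = turn-apex p
  turns-apex r2 p = turn-apex (turn-apex p)
  turns-apex r3 p = turn-apex (turn-apex (turn-apex p))

  dihedral-apex : ∀ d {e} → Apex e → Apex (dihedral d e)
  dihedral-apex (z , false) p = turns-apex z p
  dihedral-apex (z , true)  p = turns-apex z (rotate-apex p)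

  swapApex-apex : ∀ {e} → Apex e → swapApex e ≢ e
  swapApex-apex bot ()
  swapApex-apex top ()

  power-injective : ∀ c c′ {e} → Apex e → power swapApex c e ≡ power swapApex c′ e → c ≡ c′
  power-injective false false _ _ = refl
  power-injective false true  p q = ⊥-elim (swapApex-apex p (sym q))
  power-injective true  false p q = ⊥-elim (swapApex-apex p q)
  power-injective true  true  _ _ = refl

  -- `swapApex` fixes the corners, so they determine the dihedral part. The last bit is then read
  -- off the image of `bot`, since `swapApex` moves both apex facets.
  action-injective : ∀ g h → (∀ {e} → Ok e → action g e ≡ action h e) → g ≡ h
  action-injective (d , c) (d′ , c′) eq with dihedral-injective d d′ (λ z →
      trans (cong (dihedral d) (sym (swapApex-corner c z))) (trans (eq (corner-ok z)) (cong (dihedral d′) (swapApex-corner c′ z))))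
  ... | refl = cong (d ,_) (power-injective c c′ (dihedral-apex d bot) (trans (swapApex-dihedral c d {bot} tt) (trans (eq {bot} tt) (sym (swapApex-dihedral c′ d {bot} tt)))))

-- Every automorphism is generated

κ-post : ∀ {A B A′ B′} → Iso A B A′ B′ → Iso A B B′ A′
κ-post {A′ = A′} {B′} I = record
  { to = κ ∘ to ; from = from ∘ κ
  ; to-valid = κ-valid A′ B′ ∘ to-valid ; from-valid = from-valid ∘ κ-valid B′ A′
  ; from-to = λ {e} v → trans (cong from (κ-involutive (to e))) (from-to v)
  ; to-from = λ {e} v → trans (cong κ (to-from (κ-valid B′ A′ v))) (κ-involutive e)
  ; to-opp = κ-opp A′ B′ ∘ to-opp ; from-opp = from-opp ∘ κ-opp B′ A′ }
  where open Iso I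

module Realization (a b : ℕ) where

  open Generators a b public

  0<A : 0 < A
  0<A = s≤s z≤n

  0<B : 0 < B
  0<B = s≤s z≤n

  ∘-♯ : ∀ {α σ} → Acts α σ → ∀ β {e} → Ok e → ((α ∘A β) ♯) e ≡ σ ((β ♯) e)
  ∘-♯ {α} {σ} s β = acts-unique {α ∘A β} {(α ∘A β) ♯} {σ ∘ (β ♯)} (♯-acts (α ∘A β)) (acts-∘ {α} {β} {σ} {β ♯} s (♯-acts β))

  StartCorner : Aut′ → Set
  StartCorner α = (α ♯) (H 0 0) ≡ H 0 0 × (α ♯) (V 0 0) ≡ V 0 0

  -- The group is a parameter so that the same reductions serve the groups with and without `κ`.
  module Representation (G : FinGrp) (act : Carrier G → Facet → Facet) (aut : Carrier G → Aut′) (acts : ∀ g → Acts (aut g) (act g))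
    (hom : ∀ g h {e} → Ok e → act (_·_ G g h) e ≡ act g (act h e)) where

    Realized : Aut′ → Set
    Realized α = ∃ λ g → ∀ {e} → Ok e → act g e ≡ (α ♯) e

    reduce : ∀ h α → (∀ {e} → Ok e → act h (act h e) ≡ e) → Realized (aut h ∘A α) → Realized α
    reduce h α inv (g , eq) = _·_ G h g , λ {e} o → trans (hom h g o)
      (trans (cong (act h) (trans (eq o) (∘-♯ {aut h} {act h} (acts h) α o))) (inv (proj₁ (♯-acts α o))))

    realized⇒iso : (∀ g h → (∀ {e} → Ok e → act g e ≡ act h e) → g ≡ h) → (∀ α → Realized α) → AutIso (suc B) (suc A) G
    realized⇒iso inj all = aut
      , (λ g h → acts-≡ {aut (_·_ G g h)} {aut g ∘A aut h} {act (_·_ G g h)} {act g ∘ act h}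
                   (acts _) (acts-∘ {aut g} {aut h} {act g} {act h} (acts g) (acts h)) (λ {e} o → hom g h {e} o))
      , (λ g h eq → inj g h (acts-injective {aut g} {aut h} {act g} {act h} (acts g) (acts h) eq))
      , (λ α → proj₁ (all α) , acts-≡ {aut _} {α} {act _} {α ♯} (acts _) (♯-acts α) (proj₂ (all α)))

    module _ (hᵗ hʳ : Carrier G) (actᵗ : ∀ {e} → Ok e → act hᵗ e ≡ twist e) (actʳ : ∀ {e} → Ok e → act hʳ e ≡ rotate e) where

      reduceᵗ : ∀ α → Realized (aut hᵗ ∘A α) → Realized α
      reduceᵗ α = reduce hᵗ α λ {e} o → trans (cong (act hᵗ) (actᵗ o)) (trans (actᵗ (twist-ok o)) (twist-involutive e))

      reduceʳ : ∀ α → Realized (aut hʳ ∘A α) → Realized α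
      reduceʳ α = reduce hʳ α λ o → trans (cong (act hʳ) (actʳ o)) (trans (actʳ (rotate-ok o)) (rotate-involutive o))

      -- By `corner-image` the start pair lands on one of the two corner pairs, in one of two
      -- orders. `rotate` brings it back from the far corner and `twist` corrects the order.
      from-start : (∀ α → StartCorner α → Realized α) → ∀ α → Realized α
      from-start r α = go refl refl (corner-image (iso α) 0<A 0<B)
        where
        step-by : ∀ h {σ : Facet → Facet} → (∀ {e} → Ok e → act h e ≡ σ e) → ∀ α {e f} → Ok e → (α ♯) e ≡ f → ((aut h ∘A α) ♯) e ≡ σ f
        step-by h {σ} eq α o p = trans (∘-♯ {aut h} {act h} (acts h) α o) (trans (eq (proj₁ (♯-acts α o))) (cong σ p))

        H₀ = corner-ok r0
        V₀ = corner-ok r2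

        twisted : ∀ α → (α ♯) (H 0 0) ≡ V 0 0 → (α ♯) (V 0 0) ≡ H 0 0 → Realized α
        twisted α p q = reduceᵗ α (r (aut hᵗ ∘A α) (step-by hᵗ {twist} actᵗ α H₀ p , step-by hᵗ {twist} actᵗ α V₀ q))

        go : ∀ {e f} → (α ♯) (H 0 0) ≡ e → (α ♯) (V 0 0) ≡ f → Corner (iso α) 0<A 0<B e f → Realized α
        go p q startHV = r α (p , q)
        go p q startVH = twisted α p q
        go p q endHV = reduceʳ α (r (aut hʳ ∘A α) ( trans (step-by hʳ {rotate} actʳ α H₀ p) (rotate-corner r1)
                                                  , trans (step-by hʳ {rotate} actʳ α V₀ q) (rotate-corner r3)))
        go p q endVH = reduceʳ α (twisted (aut hʳ ∘A α) (trans (step-by hʳ {rotate} actʳ α H₀ p) (rotate-corner r3))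
                                                        (trans (step-by hʳ {rotate} actʳ α V₀ q) (rotate-corner r1)))

  open Representation (D4 ⊗ Z2) action action-aut action-acts action-hom public

  action-♯ : ∀ h α {e f} → Ok e → (α ♯) e ≡ f → ((action-aut h ∘A α) ♯) e ≡ action h f
  action-♯ h α o p = trans (∘-♯ {action-aut h} {action h} (action-acts h) α o) (cong (action h) p)

  WallsFixed : Aut′ → Set
  WallsFixed α = (∀ {i k} → Ok (H i k) → (α ♯) (H i k) ≡ H i k) × (∀ {i k} → Ok (V i k) → (α ♯) (V i k) ≡ V i k)

  realize-walls : ∀ α → WallsFixed α → Realized α
  realize-walls α w = [ fixed α w , swapped ]′ (apex-image (iso α) 0<A 0<B {bot} tt (λ ()))
    where
    fixed : ∀ α → WallsFixed α → (α ♯) bot ≡ bot → Realized α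
    fixed α (wh , wv) p = ((r0 , false) , false) , same
      where
      top-fixed : (α ♯) top ≡ top
      top-fixed with apex-image (iso α) 0<A 0<B {top} tt (λ ())
      ... | inj₂ q = q
      ... | inj₁ q = case ♯-injective α {bot} {top} tt tt (trans p (sym q)) of λ ()
      same : ∀ {e} → Ok e → e ≡ (α ♯) e
      same {bot}   o = sym p
      same {top}   o = sym top-fixed
      same {H i k} o = sym (wh o)
      same {V i k} o = sym (wv o)

    swapped : (α ♯) bot ≡ top → Realized α
    swapped p = reduce h α (λ {e} _ → swapApex-involutive e)
      (fixed (action-aut h ∘A α) ((λ o → action-♯ h α o (proj₁ w o)) , (λ o → action-♯ h α o (proj₂ w o))) (action-♯ h α {bot} tt p))
      where h = (r0 , false) , true

  -- Acts as rotate ∘ twist ∘ rotate, the twist at the corner opposite to the start.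
  endTwist : (Z4 × Bool) × Bool
  endTwist = (r3 , true) , false

  endTwist-inner : ∀ {e} → Ok e → Inner e → action endTwist e ≡ e
  endTwist-inner o (_ , q) = trans (sym (rotate-turn o)) (trans (cong rotate q) (rotate-involutive o))

  endTwist-involutive : ∀ {e} → Ok e → action endTwist (action endTwist e) ≡ e
  endTwist-involutive {e} o = sym (action-hom endTwist endTwist o)

  diagonal-end : ∀ {i k} → i ≤ a → k ≤ B → ¬ (2 + (i + k) ≤ A + B) → i ≡ a × k ≡ B
  diagonal-end {i} {k} p q n = ≤-antisym p (≮⇒≥ λ r → big (+-mono-≤ r q)) , ≤-antisym q (≮⇒≥ λ r → big (subst (_≤ a + B) (+-suc i k) (+-mono-≤ p r)))
    where big : ¬ (suc (i + k) ≤ a + B)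
          big r = n (s≤s r)

  -- The antidiagonals up to `A + B - 2` contain all facets `H` and `V` except `H a B` and `V A b`.
  -- The last square allows these two to be exchanged, and `endTwist` undoes exactly that.
  realize-levels : ∀ α → (∀ d → 2 + d ≤ A + B → Level (iso α) d) → Realized α
  realize-levels α l = [ straight , crossed ]′ (proj₁ (proj₂ ends-far))
    where
    near-end : (Ok (H a b) → (α ♯) (H a b) ≡ H a b) × (Ok (V a b) → (α ♯) (V a b) ≡ V a b)
    near-end = l (a + b) (≤-reflexive (cong suc (sym (+-suc a b)))) a b refl
    h = proj₁ near-end (≤-refl , n≤1+n b)
    v = proj₂ near-end (n≤1+n a , ≤-refl)
    ends-far = near⇒far (iso α) ≤-refl ≤-refl h v

    walls : ∀ β → (∀ {e} → Ok e → e ≢ H a B → e ≢ V A b → (α ♯) e ≡ e → (β ♯) e ≡ e) → (β ♯) (H a B) ≡ H a B → (β ♯) (V A b) ≡ V A b → WallsFixed β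
    walls β k p q = wall-H , wall-V
      where
      wall-H : ∀ {i k} → Ok (H i k) → (β ♯) (H i k) ≡ H i k
      wall-H {i} {j} o with 2 + (i + j) ≤? A + B
      ... | no r with diagonal-end (s≤s⁻¹ (proj₁ o)) (proj₂ o) r
      ...   | refl , refl = p
      wall-H {i} {j} o | yes r = k o (λ { refl → 1+n≰n r }) (λ ()) (proj₁ (l (i + j) r i j refl) o)
      wall-V : ∀ {i k} → Ok (V i k) → (β ♯) (V i k) ≡ V i k
      wall-V {i} {j} o with 2 + (i + j) ≤? A + B
      ... | yes r = k o (λ ()) (λ { refl → 1+n≰n (subst (2 + (A + b) ≤_) (+-suc A b) r) }) (proj₂ (l (i + j) r i j refl) o)
      ... | no r with ≤-antisym (proj₁ o) (≮⇒≥ λ x → r (subst (_≤ A + B) (cong suc (+-suc i j)) (+-mono-≤ x (proj₂ o))))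
      ...   | refl with ≤-antisym (s≤s⁻¹ (proj₂ o)) (≮⇒≥ λ x → r (subst (_≤ A + B) (trans (+-suc A (suc j)) (cong suc (+-suc A j))) (+-monoʳ-≤ A (s≤s x))))
      ...     | refl = q

    straight : (α ♯) (H a B) ≡ H a B → Realized α
    straight p = realize-walls α (walls α (λ _ _ _ x → x) p (proj₂ (far-fixed (iso α) ≤-refl ≤-refl h v (inj₁ p))))

    crossed : (α ♯) (H a B) ≡ V A b → Realized α
    crossed p = reduce endTwist α endTwist-involutive (realize-walls (action-aut endTwist ∘A α) (walls (action-aut endTwist ∘A α) keep
        (trans (action-♯ endTwist α (corner-ok r1) p) (dihedral-corner (r3 , true) r3))
        (trans (action-♯ endTwist α (corner-ok r3) q) (dihedral-corner (r3 , true) r1))))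
      where
      q : (α ♯) (V A b) ≡ H a B
      q = [ id , (λ r → case ♯-injective α (corner-ok r1) (corner-ok r3) (trans p (sym r)) of λ ()) ]′ (proj₂ (proj₂ ends-far))
      unmoved : ∀ {e} → Ok e → e ≢ H a B → e ≢ V A b → action endTwist e ≡ e
      unmoved o n₁ n₂ with corner-or-inner o
      ... | inj₂ i           = endTwist-inner o i
      ... | inj₁ (r0 , refl) = dihedral-corner (r3 , true) r0
      ... | inj₁ (r1 , p)    = ⊥-elim (n₁ p)
      ... | inj₁ (r2 , refl) = dihedral-corner (r3 , true) r2
      ... | inj₁ (r3 , p)    = ⊥-elim (n₂ p)
      keep : ∀ {e} → Ok e → e ≢ H a B → e ≢ V A b → (α ♯) e ≡ e → ((action-aut endTwist ∘A α) ♯) e ≡ e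
      keep o n₁ n₂ x = trans (action-♯ endTwist α o x) (unmoved o n₁ n₂)

  realize-start : ∀ α → StartFixed (iso α) → Realized α
  realize-start α s = realize-levels α (level (iso α) 0<A 0<B s)

  near-start : ∀ α → StartCorner α → StartFixed (iso α) ⊎ ((α ♯) (H 0 1) ≡ V 1 0 × (α ♯) (V 1 0) ≡ H 0 1)
  near-start α (h , v) = decide (proj₁ (proj₂ far)) (proj₂ (proj₂ far))
    where
    far = near⇒far (iso α) 0<A 0<B h v
    decide : (α ♯) (H 0 1) ≡ H 0 1 ⊎ (α ♯) (H 0 1) ≡ V 1 0 → (α ♯) (V 1 0) ≡ H 0 1 ⊎ (α ♯) (V 1 0) ≡ V 1 0 →
             StartFixed (iso α) ⊎ ((α ♯) (H 0 1) ≡ V 1 0 × (α ♯) (V 1 0) ≡ H 0 1)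
    decide (inj₁ p) _        = inj₁ ((h , v) , far-fixed (iso α) 0<A 0<B h v (inj₁ p))
    decide (inj₂ p) (inj₁ q) = inj₂ (p , q)
    decide (inj₂ p) (inj₂ q) = case ♯-injective α {H 0 1} {V 1 0} (s≤s z≤n , s≤s z≤n) (s≤s z≤n , s≤s z≤n) (trans p (sym q)) of λ ()

  -- Up to the twist at the start, such an automorphism agrees near the start with the transposition κ.
  tilted : ∀ α → StartCorner α → (α ♯) (H 0 1) ≡ V 1 0 → (α ♯) (V 1 0) ≡ H 0 1 → StartFixed (κ-post (iso (twist-aut ∘A α)))
  tilted α (h , v) p q = (twisted (corner-ok r0) h , twisted (corner-ok r2) v)
                       , (twisted {H 0 1} (s≤s z≤n , s≤s z≤n) p , twisted {V 1 0} (s≤s z≤n , s≤s z≤n) q)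
    where
    twisted : ∀ {e f} → Ok e → (α ♯) e ≡ f → κ (((twist-aut ∘A α) ♯) e) ≡ κ (twist f)
    twisted o r = cong κ (trans (∘-♯ {twist-aut} {twist} (symmetry-acts twist-symmetry) α o) (cong twist r))

  -- For `A ≢ B` a tilt is impossible by `fixed⇒≡`. For `A = B = 1` the far pair of the only square
  -- lies on the last antidiagonal, so a tilt is the crossed case of `realize-levels`, whose
  -- hypothesis concerns level 0 alone.
  untilted-iso : A ≢ B ⊎ (a ≡ 0 × b ≡ 0) → AutIso (suc B) (suc A) (D4 ⊗ Z2)
  -- `(r1 , true)` acts as `turn ∘ rotate`, which is `twist` because `rotate` is an involution.
  untilted-iso c = realized⇒iso action-injective (from-start ((r1 , true) , false) ((r0 , true) , false)
      (λ o → cong twist (rotate-involutive o)) (λ _ → refl) (realize-corner c))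
    where
    realize-tilted : A ≢ B ⊎ (a ≡ 0 × b ≡ 0) → ∀ α → StartCorner α → (α ♯) (H 0 1) ≡ V 1 0 × (α ♯) (V 1 0) ≡ H 0 1 → Realized α
    realize-tilted (inj₁ A≢B) α s (p , q) = ⊥-elim (A≢B (fixed⇒≡ (κ-post (iso (twist-aut ∘A α))) 0<A 0<B (tilted α s p q)))
    realize-tilted (inj₂ (refl , refl)) α (h , v) _ = realize-levels α level-0
      where level-0 : ∀ d → 2 + d ≤ 2 → Level (iso α) d
            level-0 zero _ zero zero refl = (λ _ → h) , (λ _ → v)
            level-0 (suc d) (s≤s (s≤s ()))

    realize-corner : A ≢ B ⊎ (a ≡ 0 × b ≡ 0) → ∀ α → StartCorner α → Realized α
    realize-corner c α s = [ realize-start α , realize-tilted c α s ]′ (near-start α s)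

-- Square grids of side at least 2: the transposition as a further factor

module Square (c : ℕ) where

  a : ℕ
  a = suc c

  open Realization a a

  κ-symmetry : Symmetry κ
  κ-symmetry = record
    { move = flip ; move-mono = λ {v} → flip-mono A A {v} ; ok = λ {e} → κ-valid A A {e} ; involutive = λ {e} _ → κ-involutive e
    ; move-tight = λ {v} {e} _ _ → flip-tightᵗ A A v e }

  κ-rotate : ∀ e → κ (rotate e) ≡ rotate (κ e)
  κ-rotate bot     = refl
  κ-rotate top     = refl
  κ-rotate (H _ _) = refl
  κ-rotate (V _ _) = refl

  κ-twist : ∀ e → κ (twist e) ≡ twist (κ e)
  κ-twist bot                    = refl
  κ-twist top                    = refl
  κ-twist (H zero zero)          = refl
  κ-twist (H (suc _) zero)       = refl
  κ-twist (H zero (suc _))       = refl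
  κ-twist (H (suc _) (suc _))    = refl
  κ-twist (V zero zero)          = refl
  κ-twist (V zero (suc _))       = refl
  κ-twist (V (suc _) zero)       = refl
  κ-twist (V (suc _) (suc _))    = refl

  κ-swapApex : ∀ e → κ (swapApex e) ≡ swapApex (κ e)
  κ-swapApex bot     = refl
  κ-swapApex top     = refl
  κ-swapApex (H _ _) = refl
  κ-swapApex (V _ _) = refl

  κ-power-swapApex : ∀ x e → κ (power swapApex x e) ≡ power swapApex x (κ e)
  κ-power-swapApex true  e = κ-swapApex e
  κ-power-swapApex false e = refl

  κ-action : ∀ w g {e} → Ok e → power κ w (action g e) ≡ action g (power κ w e)
  κ-action w (d , x) = power-commute {κ} {action (d , x)} (λ {e} o → trans
    (dihedral-commute {κ} (λ {e} _ → κ-rotate e) (λ {e} _ → κ-twist e) d (power-swapApex-ok x o))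
    (cong (dihedral d) (κ-power-swapApex x e))) w

  G : FinGrp
  G = (D4 ⊗ Z2) ⊗ Z2^ 1

  κ-aut : Aut′
  κ-aut = symmetry κ-symmetry

  power-κ-ok : ∀ w {e} → Ok e → Ok (power κ w e)
  power-κ-ok true  {e} o = κ-valid A A {e} o
  power-κ-ok false o = o

  actionᵏ : Carrier G → Facet → Facet
  actionᵏ (g , w ∷ []) e = action g (power κ w e)

  autᵏ : Carrier G → Aut′
  autᵏ (g , w ∷ []) = action-aut g ∘A power-aut κ-aut w

  actsᵏ : ∀ g → Acts (autᵏ g) (actionᵏ g)
  actsᵏ (g , w ∷ []) = acts-∘ {action-aut g} {power-aut κ-aut w} {action g} {power κ w} (action-acts g)
    (power-acts {κ-aut} {κ} (symmetry-acts κ-symmetry) w)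

  homᵏ : ∀ g h {e} → Ok e → actionᵏ (_·_ G g h) e ≡ actionᵏ g (actionᵏ h e)
  homᵏ (g , w ∷ []) (h , w′ ∷ []) {e} o = trans (action-hom g h (power-κ-ok (w xor w′) o)) (cong (action g)
    (trans (cong (action h) (power-xor κ-involutive w w′ e)) (sym (κ-action w h (power-κ-ok w′ o)))))

  module Repᵏ = Representation G actionᵏ autᵏ actsᵏ homᵏ

  -- The facets `H i k` with `0 < k < B`, such as `H 0 1`. They avoid the corners, so the group
  -- generated by the other symmetries keeps them of type `H`, whereas `κ` turns them into type `V`;
  -- this detects the exponent of `κ`.
  InnerH : Facet → Set
  InnerH e = ∃ λ i → ∃ λ k → k < a × e ≡ H i (suc k)

  rotate-innerH : ∀ {e} → InnerH e → InnerH (rotate e)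
  rotate-innerH (i , k , p , refl) = A ∸ suc i , c ∸ k , s≤s (m∸n≤m c k) , cong (H (A ∸ suc i)) (∸-step p)

  turn-innerH : ∀ {e} → InnerH e → InnerH (turn e)
  turn-innerH x with rotate-innerH x
  ... | i , k , p , q = i , k , p , cong twist q

  turns-innerH : ∀ z {e} → InnerH e → InnerH (turns z e)
  turns-innerH r0 x = x
  turns-innerH r1 x = turn-innerH x
  turns-innerH r2 x = turn-innerH (turn-innerH x)
  turns-innerH r3 x = turn-innerH (turn-innerH (turn-innerH x))

  action-innerH : ∀ g → InnerH (action g (H 0 1))
  action-innerH ((z , false) , false) = turns-innerH z (0 , 0 , s≤s z≤n , refl)
  action-innerH ((z , false) , true)  = turns-innerH z (0 , 0 , s≤s z≤n , refl)
  action-innerH ((z , true) , false)  = turns-innerH z (rotate-innerH (0 , 0 , s≤s z≤n , refl))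
  action-innerH ((z , true) , true)   = turns-innerH z (rotate-innerH (0 , 0 , s≤s z≤n , refl))

  power-κ-injective : ∀ w w′ {e f} → InnerH e → InnerH f → power κ w e ≡ power κ w′ f → w ≡ w′
  power-κ-injective false false _ _ _ = refl
  power-κ-injective true  true  _ _ _ = refl
  power-κ-injective false true  (_ , _ , _ , refl) (_ , _ , _ , refl) ()
  power-κ-injective true  false (_ , _ , _ , refl) (_ , _ , _ , refl) ()

  injectiveᵏ : ∀ g h → (∀ {e} → Ok e → actionᵏ g e ≡ actionᵏ h e) → g ≡ h
  injectiveᵏ (g , w ∷ []) (h , w′ ∷ []) eq with power-κ-injective w w′ (action-innerH g) (action-innerH h)
      (trans (κ-action w g H₁) (trans (eq {H 0 1} H₁) (sym (κ-action w′ h H₁))))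
    where H₁ : Ok (H 0 1)
          H₁ = s≤s z≤n , s≤s z≤n
  ... | refl = cong (_, w ∷ []) (action-injective g h λ {e} o → trans (cong (action g) (sym (cancel w e)))
                 (trans (eq (power-κ-ok w o)) (cong (action h) (cancel w e))))
    where cancel : ∀ w e → power κ w (power κ w e) ≡ e
          cancel true  e = κ-involutive e
          cancel false e = refl

  square-iso : AutIso (suc A) (suc A) G
  square-iso = Repᵏ.realized⇒iso injectiveᵏ (Repᵏ.from-start hᵗ hʳ actᵗ (λ _ → refl) realize-corner)
    where
    hᵗ hʳ hᵏ : Carrier G
    hᵗ = ((r1 , true) , false) , false ∷ []
    hʳ = ((r0 , true) , false) , false ∷ []
    hᵏ = ((r0 , false) , false) , true ∷ []

    actᵗ : ∀ {e} → Ok e → actionᵏ hᵗ e ≡ twist e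
    actᵗ o = cong twist (rotate-involutive o)

    untilted : ∀ α → StartFixed (iso α) → Repᵏ.Realized α
    untilted α s = (proj₁ (realize-start α s) , false ∷ []) , proj₂ (realize-start α s)

    H₁ : Ok (H 0 1)
    H₁ = s≤s z≤n , s≤s z≤n

    V₁ : Ok (V 1 0)
    V₁ = s≤s z≤n , s≤s z≤n

    straighten : Aut′ → Aut′
    straighten α = autᵏ hᵏ ∘A (autᵏ hᵗ ∘A α)

    straighten-♯ : ∀ α {e} → Ok e → κ (((twist-aut ∘A α) ♯) e) ≡ e → (straighten α ♯) e ≡ e
    straighten-♯ α {e} o r = trans (∘-♯ {autᵏ hᵏ} {actionᵏ hᵏ} (actsᵏ hᵏ) (autᵏ hᵗ ∘A α) o) (trans (cong κ
      (trans (∘-♯ {autᵏ hᵗ} {actionᵏ hᵗ} (actsᵏ hᵗ) α o) (trans (actᵗ (proj₁ (♯-acts α o)))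
        (sym (∘-♯ {twist-aut} {twist} (symmetry-acts twist-symmetry) α o))))) r)

    straighten-start : ∀ α → StartFixed (κ-post (iso (twist-aut ∘A α))) → StartFixed (iso (straighten α))
    straighten-start α ((x , y) , (z , w)) = (straighten-♯ α (corner-ok r0) x , straighten-♯ α (corner-ok r2) y)
                                           , (straighten-♯ α H₁ z , straighten-♯ α V₁ w)

    realize-tilted : ∀ α → StartCorner α → (α ♯) (H 0 1) ≡ V 1 0 × (α ♯) (V 1 0) ≡ H 0 1 → Repᵏ.Realized α
    realize-tilted α s (p , q) = Repᵏ.reduceᵗ hᵗ hʳ actᵗ (λ _ → refl) α
      -- With `A = B` the transposed grid is the same one, so `κ ∘ twist ∘ α` is an automorphism
      -- with all four sides of the first square fixed; it is realized as an untilted one.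
      (Repᵏ.reduce hᵏ (autᵏ hᵗ ∘A α) (λ {e} _ → κ-involutive e) (untilted (straighten α) (straighten-start α (tilted α s p q))))

    realize-corner : ∀ α → StartCorner α → Repᵏ.Realized α
    realize-corner α s = [ untilted α , realize-tilted α s ]′ (near-start α s)

with-trivial : ∀ {a₁ a₂ G} → AutIso a₁ a₂ G → AutIso a₁ a₂ (G ⊗ Z2^ 0)
with-trivial (φ , hom , inj , sur) = (λ (g , _) → φ g) , (λ (g , _) (h , _) → hom g h) , inj′ , (λ α → (proj₁ (sur α) , []) , proj₂ (sur α))
  where inj′ : ∀ g h → AutEq (φ (proj₁ g)) (φ (proj₁ h)) → g ≡ h
        inj′ (g , []) (h , []) eq = cong (_, []) (inj g h eq)

δ-refl : ∀ n → δ n n ≡ 1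
δ-refl n = cong (if_then 1 else 0) (dec-true (n ≟ n) refl)

δ-≢ : ∀ {m n} → m ≢ n → δ m n ≡ 0
δ-≢ {m} {n} p = cong (if_then 1 else 0) (dec-false (m ≟ n) p)

large-iso : ∀ b a → Dec (b ≡ a) → ¬ (b ≡ 0 × a ≡ 0) →
            AutIso (suc (suc b)) (suc (suc a)) ((D4 ⊗ Z2) ⊗ Z2^ (δ b a))
large-iso b a (no b≢a) _ = subst (λ d → AutIso (suc (suc b)) (suc (suc a)) ((D4 ⊗ Z2) ⊗ Z2^ d)) (sym (δ-≢ b≢a))
  (with-trivial (Realization.untilted-iso a b (inj₁ (b≢a ∘ sym ∘ suc-injective))))
large-iso zero    .zero    (yes refl) n = ⊥-elim (n (refl , refl))
large-iso (suc c) .(suc c) (yes refl) _ = subst (λ d → AutIso (suc (suc (suc c))) (suc (suc (suc c))) ((D4 ⊗ Z2) ⊗ Z2^ d)) (sym (δ-refl (suc c))) (Square.square-iso c)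

theorem1p2 : (a₁ a₂ : ℕ) → a₁ ≥ 2 → a₂ ≥ 2 →
    ((a₁ ≡ 2 × a₂ ≡ 2) → AutIso a₁ a₂ (D4 ⊗ Z2))
    × (¬ (a₁ ≡ 2 × a₂ ≡ 2) → AutIso a₁ a₂ ((D4 ⊗ Z2) ⊗ Z2^ (δ a₁ a₂)))
theorem1p2 (suc (suc b)) (suc (suc a)) (s≤s (s≤s z≤n)) (s≤s (s≤s z≤n)) =
    (λ { (refl , refl) → Realization.untilted-iso 0 0 (inj₂ (refl , refl)) })
  , (λ n → large-iso b a (b ≟ a) (λ (p , q) → n (cong (2 +_) p , cong (2 +_) q)))
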